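{- Let $G=(V,E,w)$ be a weighted graph with edge weights in $[1,W]$. Let $A$ be an algorithm which, for every (unweighted) graph with maximum matching $M$, returns a value $\widehat{M}$ with $\frac{1}{\lambda}|M|\le \widehat{M}\le |M|$ with failure probability at most $\delta$ and needs space $S$. Partition $E$ into sets $E_0,\dots,E_t$ with $t=\lfloor \log_2 W\rfloor$, where $E_i$ consists of all edges with weight in $[2^i,2^{i+1})$, and set $r_i=2^i$. Then there are parameters $T$ and $c$ depending only on $\lambda$ such that the Weighted Matching Approximation algorithm (described in the context), run with these parameters and with $A$ as the unweighted matching estimator, returns an $O(\lambda^4)$-estimator $\widehat{W}$ for the weight of a maximum weighted matching, with failure probability at most $\delta\cdot(t+1)$ and using $O(S\cdot (t+1))$ space. That is, there is an absolute constant $K>0$ such that, with probability at least $1-\delta (t+1)$, $$\frac{1}{K\lambda^4}\cdot w(M^*)\le \widehat{W}\le w(M^*),$$ where $M^*$ is a maximum weight matching of $G$ and $w(M^*)=\sum_{e\in M^*}w(e)$.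
   Context: Here $\lambda\ge 1$. The graph is presented as a stream of edge updates (insertions, or insertions and deletions), each update carrying the edge weight; $A$ is a streaming algorithm in the same streaming model, and one copy of $A$ is run for each of the $t+1$ subgraphs used below. Weighted Matching Approximation algorithm with parameters $T,c$: Initialize $\widehat{S_i}=\widehat{R_i}=0$ for $i=0,\dots,t$ and $last=t$. Set $\widehat{R_t}=\widehat{S_t}$ to be the output of $A$ on $(V,E_t)$. For $i=t-1,t-2,\dots,0$: set $\widehat{S_i}$ to be the output of $A$ on $(V,\bigcup_{j=i}^t E_j)$; if $\widehat{S_i}>T\cdot\widehat{S_{last}}$, then check whether $\widehat{S_i}-\widehat{S_{last}}\ge c\cdot\widehat{R_{last}}$ and, if so, set $\widehat{R_i}=\widehat{S_i}-\widehat{S_{last}}$ and then $last=i$; otherwise (if $\widehat{S_i}\le T\cdot\widehat{S_{last}}$) set $\widehat{S_i}=0$. Return $\widehat{W}=\frac{2}{5}\sum_{i=0}^t r_i\cdot\widehat{R_i}$. -}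

module Defs where

open import Level using (Level; _⊔_; suc; 0ℓ)
open import Algebra.Bundles using (CommutativeRing; Semiring)
open import Algebra.Structures using (IsCommutativeRing)
import Algebra.Definitions.RawSemiring as RawSemiringDefs
open import Data.Bool.Base using (Bool; true; false; if_then_else_; not; _∧_; _∨_)
open import Data.Empty.Polymorphic using (⊥)
open import Data.Fin.Base as Fin using (Fin; toℕ; fromℕ; inject₁)
open import Data.Fin.Properties as Fin using (any?)
open import Data.List.Base as List using (List; []; _∷_; allFin; foldl; length)
open import Data.List.Relation.Unary.All using (All)
open import Data.List.Relation.Unary.AllPairs using (AllPairs)
open import Data.Maybe using (Maybe; just; nothing; Is-just; fromMaybe)
open import Data.Maybe.Relation.Binary.Pointwise using (Pointwise)
import Data.Maybe.Relation.Unary.All as Maybe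
open import Data.Nat.Base as ℕ using (ℕ)
open import Data.Product.Base using (Σ-syntax; ∃-syntax; _×_; _,_)
open import Data.Unit.Base using (⊤; tt)
import Data.Unit.Polymorphic.Base as Poly
open import Data.Vec.Functional as Vector using (Vector; updateAt; replicate)
open import Function.Base using (_∘_; const)
open import Relation.Binary.Bundles using (Setoid)
open import Relation.Binary.Core using (Rel)
open import Relation.Binary.PropositionalEquality
  using (_≡_; _≢_; _≗_; refl; setoid)
open import Relation.Binary.Structures using (IsDecTotalOrder)
import Relation.Binary.Construct.NonStrictToStrict as NonStrictToStrict
open import Relation.Nullary.Decidable.Core using (Dec; yes; no; does; _×-dec_)
open import Relation.Nullary.Negation.Core using (¬_)

-- The standard library has no real numbers.  All real quantities below are
-- taken in an arbitrary ordered field with decidable order; ℚ is one, and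
-- classically so is ℝ.

record OrderedField c ℓ₁ ℓ₂ : Set (suc (c ⊔ ℓ₁ ⊔ ℓ₂)) where
  infix  8 _⁻¹
  infixl 7 _*_
  infixl 6 _+_
  infix  4 _≈_ _≤_
  field
    Carrier           : Set c
    _≈_               : Rel Carrier ℓ₁
    _≤_               : Rel Carrier ℓ₂
    _+_ _*_           : Carrier → Carrier → Carrier
    -_                : Carrier → Carrier
    0# 1#             : Carrier
    isCommutativeRing : IsCommutativeRing _≈_ _+_ _*_ -_ 0# 1#
    isDecTotalOrder   : IsDecTotalOrder _≈_ _≤_
    0≉1               : ¬ 0# ≈ 1#
    +-monoʳ-≤         : ∀ x {y z} → y ≤ z → x + y ≤ x + z
    *-nonNeg          : ∀ {x y} → 0# ≤ x → 0# ≤ y → 0# ≤ x * y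
    -- The value of 0# ⁻¹ is unconstrained.
    _⁻¹               : Carrier → Carrier
    ⁻¹-cong           : ∀ {x y} → x ≈ y → x ⁻¹ ≈ y ⁻¹
    *-inverseʳ        : ∀ {x} → ¬ x ≈ 0# → x * x ⁻¹ ≈ 1#

  commutativeRing : CommutativeRing c ℓ₁
  commutativeRing = record { isCommutativeRing = isCommutativeRing }

  open IsCommutativeRing isCommutativeRing public using (_-_)
  open IsDecTotalOrder isDecTotalOrder public using (_≟_; _≤?_)
  open NonStrictToStrict _≈_ _≤_ public using (_<_; <-decidable)
  open RawSemiringDefs (Semiring.rawSemiring (CommutativeRing.semiring commutativeRing)) public
    using (_^_; sum) renaming (_×_ to _·_)

  infix 4 _<?_
  _<?_ : (x y : Carrier) → Dec (x < y)
  _<?_ = <-decidable _≟_ _≤?_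

  ≈-setoid : Setoid c ℓ₁
  ≈-setoid = CommutativeRing.setoid commutativeRing

  ι : ℕ → Carrier
  ι n = n · 1#

record Edge (n : ℕ) : Set where
  constructor edge
  field
    lo hi   : Fin n
    .lo<hi  : lo Fin.< hi

_≟ᴱ_ : ∀ {n} (e f : Edge n) → Dec (e ≡ f)
edge u v _ ≟ᴱ edge u′ v′ _ with u Fin.≟ u′ | v Fin.≟ v′
... | yes refl | yes refl = yes refl
... | no u≢u′  | _        = no λ { refl → u≢u′ refl }
... | yes _    | no v≢v′  = no λ { refl → v≢v′ refl }

-- A graph whose edges carry labels in L: G e is the label of e, or nothing
-- if e is not an edge.  Unweighted graphs have labels in ⊤.
Graph : ∀ {a} → Set a → ℕ → Set a
Graph L n = Edge n → Maybe L

Disjoint : ∀ {n} → Edge n → Edge n → Set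
Disjoint (edge u v _) (edge u′ v′ _) = u ≢ u′ × u ≢ v′ × v ≢ u′ × v ≢ v′

-- No edge is Disjoint from itself, so the edges listed are distinct.
record IsMatching {a} {L : Set a} {n} (G : Graph L n) (M : List (Edge n)) : Set a where
  field
    edges    : All (λ e → Is-just (G e)) M
    disjoint : AllPairs Disjoint M

record IsMaximumMatching {a} {L : Set a} {n} (G : Graph L n) (M : List (Edge n)) : Set a where
  field
    isMatching : IsMatching G M
    maximum    : ∀ M′ → IsMatching G M′ → length M′ ℕ.≤ length M

data Model : Set where
  insertOnly dynamic : Model

-- A deletion also carries the label of the deleted edge.
data Update {a} (L : Set a) (n : ℕ) : Set a where
  ins del : Edge n → L → Update L n

Stream : ∀ {a} → Set a → ℕ → Set a
Stream L n = List (Update L n)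

module _ {a} {L : Set a} {n : ℕ} where

  _[_]≔_ : Graph L n → Edge n → Maybe L → Graph L n
  (G [ e ]≔ x) f = if does (e ≟ᴱ f) then x else G f

  apply : Graph L n → Update L n → Graph L n
  apply G (ins e l) = G [ e ]≔ just l
  apply G (del e _) = G [ e ]≔ nothing

  empty : Graph L n
  empty _ = nothing

module _ {a ℓ} (L : Setoid a ℓ) {n : ℕ} where
  open Setoid L using (_≈_) renaming (Carrier to Label)

  Legal : Model → Graph Label n → Update Label n → Set (a ⊔ ℓ)
  Legal _          G (ins e _) = Poly.⊤ {ℓ} × G e ≡ nothing
  Legal insertOnly G (del _ _) = ⊥
  Legal dynamic    G (del e l) = Pointwise _≈_ (G e) (just l)

  ValidFrom : Model → Graph Label n → Stream Label n → Set (a ⊔ ℓ)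
  ValidFrom m G []       = Poly.⊤
  ValidFrom m G (u ∷ us) = Legal m G u × ValidFrom m (apply G u) us

  Valid : Model → Stream Label n → Set (a ⊔ ℓ)
  Valid m = ValidFrom m empty

  record Presents (m : Model) (us : Stream Label n) (G : Graph Label n) : Set (a ⊔ ℓ) where
    field
      valid : Valid m us
      final : ∀ e → Pointwise _≈_ (foldl apply empty us e) (G e)

module _ {c ℓ₁ ℓ₂} (F : OrderedField c ℓ₁ ℓ₂) where
  open OrderedField F

  -- Only finite additivity is demanded, so every probability space in the
  -- usual sense is an instance.  Events are given by their indicator functions.
  record ProbabilitySpace o e : Set (suc (o ⊔ e) ⊔ c ⊔ ℓ₁ ⊔ ℓ₂) where
    field
      Ω       : Set o
      IsEvent : (Ω → Bool) → Set e
      whole   : IsEvent (const true)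
      compl   : ∀ {X} → IsEvent X → IsEvent (not ∘ X)
      union   : ∀ {X Y} → IsEvent X → IsEvent Y → IsEvent (λ ω → X ω ∨ Y ω)
      ℙ       : ∀ X → IsEvent X → Carrier
      ℙ-cong  : ∀ {X Y} (p : IsEvent X) (q : IsEvent Y) → X ≗ Y → ℙ X p ≈ ℙ Y q
      ℙ-nonNeg : ∀ {X} (p : IsEvent X) → 0# ≤ ℙ X p
      ℙ-whole : ℙ (const true) whole ≈ 1#
      ℙ-add   : ∀ {X Y} (p : IsEvent X) (q : IsEvent Y) →
                (∀ ω → X ω ∧ Y ω ≡ false) →
                ℙ (λ ω → X ω ∨ Y ω) (union p q) ≈ ℙ X p + ℙ Y q

  -- Good holds outside an event of probability at most δ.
  FailsWithProbability≤ : ∀ {o e g} (Pr : ProbabilitySpace o e) → Carrier →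
                          (ProbabilitySpace.Ω Pr → Set g) → Set (ℓ₂ ⊔ o ⊔ e ⊔ g)
  FailsWithProbability≤ Pr δ Good =
    Σ[ X ∈ (Ω → Bool) ] Σ[ p ∈ IsEvent X ] (ℙ X p ≤ δ × (∀ ω → X ω ≡ false → Good ω))
    where open ProbabilitySpace Pr

  -- The seed ω fixes all random choices; whatever randomness is not charged
  -- for may be kept in the state without contributing to space.
  record StreamingAlgorithm {a o} s (L : Set a) (n : ℕ) (Ω : Set o) : Set (a ⊔ o ⊔ c ⊔ suc s) where
    field
      State   : Set s
      init    : Ω → State
      step    : State → Update L n → State
      output  : State → Carrier
      -- Words of memory (each holding one number or index) needed to hold
      -- the state and to evaluate the output from it, including the one
      -- word for the output itself.
      space   : State → ℕ
      1≤space : ∀ σ → 1 ℕ.≤ space σ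

    run : Ω → Stream L n → State
    run ω = foldl step (init ω)

    result : Ω → Stream L n → Carrier
    result ω us = output (run ω us)

  UsesSpace : ∀ {a ℓ o s} (L : Setoid a ℓ) {n} {Ω : Set o} → Model → ℕ →
              StreamingAlgorithm s (Setoid.Carrier L) n Ω → Set (a ⊔ ℓ ⊔ o)
  UsesSpace L m S A = ∀ ω us → Valid L m us → space (run ω us) ℕ.≤ S
    where open StreamingAlgorithm A

  module _ {o e s} (Pr : ProbabilitySpace o e) {n : ℕ}
           (A : StreamingAlgorithm s ⊤ n (ProbabilitySpace.Ω Pr)) where
    open StreamingAlgorithm A

    EstimatesMatching : Model → (Λ δ : Carrier) → Set (ℓ₂ ⊔ o ⊔ e)
    EstimatesMatching m Λ δ =
      ∀ (G : Graph ⊤ n) us → Presents (setoid ⊤) m us G →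
      ∀ M → IsMaximumMatching G M →
      FailsWithProbability≤ Pr δ λ ω →
        Λ ⁻¹ * ι (length M) ≤ result ω us × result ω us ≤ ι (length M)

  -- A common probability space for the seeds of k copies of an algorithm:
  -- each seed has distribution Pr, and the joint distribution is arbitrary
  -- (in particular, possibly independent).
  record Copies {o e} o′ e′ (Pr : ProbabilitySpace o e) (k : ℕ)
         : Set (suc (o′ ⊔ e′) ⊔ o ⊔ e ⊔ c ⊔ ℓ₁ ⊔ ℓ₂) where
    open ProbabilitySpace Pr
    field
      joint : ProbabilitySpace o′ e′
    open ProbabilitySpace joint public using () renaming
      (Ω to Ω′; IsEvent to IsEvent′; ℙ to ℙ′)
    field
      seed          : Fin k → Ω′ → Ω
      seed-event    : ∀ i {X} → IsEvent X → IsEvent′ (X ∘ seed i)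
      seed-preserve : ∀ i {X} (p : IsEvent X) →
                      ℙ′ (X ∘ seed i) (seed-event i p) ≈ ℙ X p

  WeightedGraph : ℕ → Set c
  WeightedGraph = Graph Carrier

  WeightsFrom1To : ∀ {n} → Carrier → WeightedGraph n → Set (c ⊔ ℓ₂)
  WeightsFrom1To W G = ∀ e → Maybe.All (λ x → 1# ≤ x × x ≤ W) (G e)

  -- Non-edges get the junk weight 0#; they do not occur in matchings.
  weight : ∀ {n} → WeightedGraph n → List (Edge n) → Carrier
  weight G = List.foldr (λ e x → fromMaybe 0# (G e) + x) 0#

  record IsMaximumWeightMatching {n} (G : WeightedGraph n) (M : List (Edge n)) : Set (c ⊔ ℓ₂) where
    field
      isMatching : IsMatching G M
      maximum    : ∀ M′ → IsMatching G M′ → weight G M′ ≤ weight G M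

  IsFloorLog₂ : Carrier → ℕ → Set (ℓ₁ ⊔ ℓ₂)
  IsFloorLog₂ W t = ι 2 ^ t ≤ W × W < ι 2 ^ ℕ.suc t

  r : ℕ → Carrier
  r i = ι 2 ^ i

  InClass : ℕ → Carrier → Set (ℓ₁ ⊔ ℓ₂)
  InClass i x = r i ≤ x × x < r (ℕ.suc i)

  inClass? : ∀ i x → Dec (InClass i x)
  inClass? i x = (r i ≤? x) ×-dec (x <? r (ℕ.suc i))

  -- x is the weight of an edge in E_i ∪ … ∪ E_t.
  InClasses≥ : ∀ {t} → Fin (ℕ.suc t) → Carrier → Set (ℓ₁ ⊔ ℓ₂)
  InClasses≥ {t} i x = ∃[ j ] i Fin.≤ j × InClass (toℕ {ℕ.suc t} j) x

  inClasses≥? : ∀ {t} (i : Fin (ℕ.suc t)) x → Dec (InClasses≥ i x)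
  inClasses≥? i x = any? λ j → (i Fin.≤? j) ×-dec inClass? (toℕ j) x

  record Registers (t : ℕ) : Set c where
    constructor registers
    field
      Ŝ R̂  : Vector Carrier (ℕ.suc t)
      last : Fin (ℕ.suc t)

  -- The evaluation after the stream has ended, M̂ i being the output of the
  -- copy of A run on (V , E_i ∪ … ∪ E_t).
  module Evaluation (T κ : Carrier) {t : ℕ} (M̂ : Vector Carrier (ℕ.suc t)) where

    _[_≔_] : Vector Carrier (ℕ.suc t) → Fin (ℕ.suc t) → Carrier → Vector Carrier (ℕ.suc t)
    v [ i ≔ x ] = updateAt v i (const x)

    start : Registers t
    start = registers (replicate (ℕ.suc t) 0# [ top ≔ M̂ top ])
                      (replicate (ℕ.suc t) 0# [ top ≔ M̂ top ])
                      top
      where top = fromℕ t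

    body : Fin (ℕ.suc t) → Registers t → Registers t
    body i (registers Ŝ R̂ last) =
      if does (T * Ŝ last <? M̂ i)
        then (if does (κ * R̂ last ≤? M̂ i - Ŝ last)
                then registers (Ŝ [ i ≔ M̂ i ]) (R̂ [ i ≔ M̂ i - Ŝ last ]) i
                else registers (Ŝ [ i ≔ M̂ i ]) R̂ last)
        else registers (Ŝ [ i ≔ 0# ]) R̂ last

    -- foldr applies body to the largest index first: t-1, t-2, …, 0.
    end : Registers t
    end = List.foldr (body ∘ inject₁) start (allFin t)

    Ŵ : Carrier
    Ŵ = ι 2 * ι 5 ⁻¹ * sum (λ i → r (toℕ i) * Registers.R̂ end i)

  -- Each update is passed on, without its weight, to those copies of A whose
  -- subgraph contains edges of that weight.  Besides the copies, memory is
  -- needed for the arrays Ŝ and R̂, for last, for the loop counter and for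
  -- accumulating the sum.
  weightedMatching : ∀ {o o′ s} {Ω : Set o} {Ω′ : Set o′} {n}
                     (T κ : Carrier) (t : ℕ) →
                     StreamingAlgorithm s ⊤ n Ω → (Fin (ℕ.suc t) → Ω′ → Ω) →
                     StreamingAlgorithm s Carrier n Ω′
  weightedMatching {n = n} T κ t A seed = record
    { State   = Vector A.State (ℕ.suc t)
    ; init    = λ ω i → A.init (seed i ω)
    ; step    = λ σ u i → feed i u (σ i)
    ; output  = λ σ → Evaluation.Ŵ T κ (A.output ∘ σ)
    ; space   = λ σ → 3 ℕ.+ (2 ℕ.* ℕ.suc t ℕ.+ Vector.foldr ℕ._+_ 0 (A.space ∘ σ))
    ; 1≤space = λ _ → ℕ.s≤s ℕ.z≤n
    }
    where
    module A = StreamingAlgorithm A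

    feed : Fin (ℕ.suc t) → Update Carrier n → A.State → A.State
    feed i (ins e x) σ = if does (inClasses≥? i x) then A.step σ (ins e tt) else σ
    feed i (del e x) σ = if does (inClasses≥? i x) then A.step σ (del e tt) else σ

{-# OPTIONS --safe #-}
module Submission where

-- With T = 1 and κ = 0 the algorithm records exactly the running maxima of
-- the estimates, so the suffix sum σᵢ of R̂ satisfies M̂ᵢ ≤ σᵢ ≈ M̂ⱼ for some
-- j ≥ i.  Put g₀ = 1 and gᵢ₊₁ = rᵢ; summation by parts gives
-- ∑ rᵢ R̂ᵢ ≈ ∑ gᵢ σᵢ, and for an edge of class j the sum of the gᵢ with i ≤ j
-- is rⱼ, which is its weight up to a factor 2.  So ∑ gᵢ cᵢ(M) ≤ w(M) ≤
-- 2 ∑ gᵢ cᵢ(M), where cᵢ(M) is the number of edges of M in the classes ≥ i.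
-- Let νᵢ be the size of a maximum matching in the classes ≥ i.
-- Lower bound: cᵢ(M*) ≤ νᵢ ≤ Λ M̂ᵢ ≤ Λ σᵢ, so w(M*) ≤ 2 Λ ∑ rᵢ R̂ᵢ = 5 Λ Ŵ.
-- Upper bound: σᵢ ≤ νⱼ ≤ 2 cᵢ(N) for the matching N built greedily from the
-- heaviest edge down, so ∑ rᵢ R̂ᵢ ≤ 2 w(N) ≤ 2 w(M*) and Ŵ ≤ w(M*).

open import Defs
open import Level using (Level; _⊔_)
open import Algebra.Bundles using (CommutativeRing)
import Algebra.Properties.CommutativeSemigroup as CommutativeSemigroupProperties
import Algebra.Properties.Ring as RingProperties
import Algebra.Properties.Semiring.Mult as SemiringMult
import Algebra.Properties.Semiring.Sum as SemiringSum
open import Data.Bool.Base using (Bool; true; false; if_then_else_; not; _∧_; _∨_)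
open import Data.Fin.Base as Fin using (Fin; zero; suc; toℕ; inject₁; fromℕ; fromℕ<)
import Data.Fin.Properties as Fin
open import Data.List.Base as List
  using (List; []; _∷_; length; filter; foldl; tabulate; concatMap; allFin)
open import Data.List.Membership.Propositional using (_∈_; find; lose)
open import Data.List.Membership.Propositional.Properties using (∈-allFin; ∈-concatMap⁺; ∈-filter⁺)
open import Data.List.Properties using (length-tabulate; length-removeAt′)
open import Data.List.Relation.Binary.Permutation.Propositional using (↭-sym)
open import Data.List.Relation.Binary.Permutation.Propositional.Properties using (All-resp-↭; ∈-resp-↭)
open import Data.List.Relation.Unary.All as All using (All; []; _∷_)
import Data.List.Relation.Unary.All.Properties as All
open import Data.List.Relation.Unary.AllPairs as AllPairs using (AllPairs; []; _∷_)
import Data.List.Relation.Unary.AllPairs.Properties as AllPairs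
open import Data.List.Relation.Unary.Any using (Any; here; there; any?; _─_; index)
open import Data.List.Relation.Unary.Linked.Properties using (Linked⇒AllPairs)
import Data.List.Sort as Sort
open import Data.Maybe using (Maybe; just; nothing; Is-just; fromMaybe; _>>=_)
open import Data.Maybe.Relation.Binary.Pointwise as Pointwise using (Pointwise; just; nothing)
import Data.Maybe.Relation.Unary.All as MaybeAll
open import Data.Maybe.Relation.Unary.Any as MaybeAny using (just)
open import Data.Nat.Base as ℕ using (ℕ; zero; suc; z≤n; s≤s)
import Data.Nat.Properties as ℕ
open import Data.Nat.Tactic.RingSolver using (solve-∀)
open import Data.Product.Base using (Σ-syntax; ∃-syntax; _×_; _,_; proj₁; proj₂)
open import Data.Sum.Base using (_⊎_; inj₁; inj₂)
open import Data.Unit.Base using (⊤; tt)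
import Data.Unit.Polymorphic.Base as Poly
open import Data.Vec.Functional as Vector using (Vector; updateAt; replicate)
open import Data.Vec.Functional.Properties using (updateAt-updates; updateAt-minimal)
open import Function.Base using (_∘_; id; const)
open import Function.Bundles using (mk⇔)
open import Relation.Binary.Bundles using (Setoid; DecTotalOrder)
import Relation.Binary.Construct.NonStrictToStrict as NonStrictToStrict
import Relation.Binary.Construct.On as On
open import Relation.Binary.PropositionalEquality as ≡ using (_≡_; _≢_; refl; setoid)
import Relation.Binary.Reasoning.PartialOrder as PosetReasoning
open import Relation.Binary.Structures using (IsDecTotalOrder)
open import Relation.Nullary.Decidable
  using (Dec; yes; no; does; map′; ¬?; _×-dec_; decidable-stable; dec-true; does-⇔)
open import Relation.Nullary.Negation using (¬_; contradiction; contradiction-irr)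
open import Relation.Unary using (Pred; Decidable)

-- Arithmetic and order in an ordered field.

module OrderedFieldProperties {c ℓ₁ ℓ₂} (F : OrderedField c ℓ₁ ℓ₂) where
  open OrderedField F public
  open CommutativeRing commutativeRing public
    using (sym; trans; reflexive; +-cong; +-congˡ; +-congʳ; *-congˡ; *-congʳ;
           +-identityˡ; +-identityʳ; *-identityˡ; *-identityʳ; +-assoc; *-assoc;
           +-comm; *-comm; distribˡ; distribʳ; zeroˡ; zeroʳ; -‿inverseˡ; -‿inverseʳ;
           ring; semiring; +-commutativeSemigroup; *-commutativeSemigroup)
    renaming (refl to ≈-refl)
  open RingProperties ring public using (-‿distribˡ-*; -‿distribʳ-*; -‿involutive)
  open SemiringMult semiring public using (×1-homo-*)
  open SemiringSum semiring public
    using (sum-cong-≋; ∑-distrib-+; *-distribˡ-sum; sum-replicate-zero)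
  open CommutativeSemigroupProperties +-commutativeSemigroup public
    using () renaming (x∙yz≈y∙xz to +-x∙yz≈y∙xz)
  open CommutativeSemigroupProperties *-commutativeSemigroup public
    using () renaming (x∙yz≈y∙xz to *-x∙yz≈y∙xz)
  open IsDecTotalOrder isDecTotalOrder public
    using (antisym; total; ≤-respˡ-≈; ≤-respʳ-≈)
    renaming (refl to ≤-refl; reflexive to ≤-reflexive; trans to ≤-trans)

  decTotalOrder : DecTotalOrder c ℓ₁ ℓ₂
  decTotalOrder = record { isDecTotalOrder = isDecTotalOrder }

  open PosetReasoning (DecTotalOrder.poset decTotalOrder) public hiding (start)

  ≮⇒≥ : ∀ {x y} → ¬ x < y → y ≤ x
  ≮⇒≥ = NonStrictToStrict.≮⇒≥ _≈_ _≤_ sym _≟_ ≤-reflexive total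

  ≰⇒> : ∀ {x y} → ¬ x ≤ y → y < x
  ≰⇒> = NonStrictToStrict.≰⇒> _≈_ _≤_ sym ≤-reflexive total

  <⇒≱ : ∀ {x y} → x < y → ¬ y ≤ x
  <⇒≱ = NonStrictToStrict.<⇒≱ _≈_ _≤_ antisym

  <-≤-trans : ∀ {x y z} → x < y → y ≤ z → x < z
  <-≤-trans = NonStrictToStrict.<-≤-trans _≈_ _≤_ sym ≤-trans antisym ≤-respʳ-≈

  ≤-<-trans : ∀ {x y z} → x ≤ y → y < z → x < z
  ≤-<-trans = NonStrictToStrict.≤-<-trans _≈_ _≤_ ≤-trans antisym ≤-respˡ-≈

  +-monoˡ-≤ : ∀ x {y z} → y ≤ z → y + x ≤ z + x
  +-monoˡ-≤ x {y} {z} y≤z = begin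
    y + x ≈⟨ +-comm y x ⟩
    x + y ≤⟨ +-monoʳ-≤ x y≤z ⟩
    x + z ≈⟨ +-comm x z ⟩
    z + x ∎

  +-mono-≤ : ∀ {x y u v} → x ≤ y → u ≤ v → x + u ≤ y + v
  +-mono-≤ x≤y u≤v = ≤-trans (+-monoˡ-≤ _ x≤y) (+-monoʳ-≤ _ u≤v)

  x≤y+x : ∀ {x y} → 0# ≤ y → x ≤ y + x
  x≤y+x {x} {y} 0≤y = begin
    x      ≈⟨ +-identityˡ x ⟨
    0# + x ≤⟨ +-monoˡ-≤ x 0≤y ⟩
    y + x  ∎

  x≤x+y : ∀ {x y} → 0# ≤ y → x ≤ x + y
  x≤x+y 0≤y = ≤-trans (x≤y+x 0≤y) (≤-reflexive (+-comm _ _))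

  +-nonNeg : ∀ {x y} → 0# ≤ x → 0# ≤ y → 0# ≤ x + y
  +-nonNeg 0≤x 0≤y = ≤-trans 0≤y (x≤y+x 0≤x)

  [y-x]+x≈y : ∀ x y → (y - x) + x ≈ y
  [y-x]+x≈y x y = trans (+-assoc y (- x) x) (trans (+-congˡ (-‿inverseˡ x)) (+-identityʳ y))

  x≤y⇒0≤y-x : ∀ {x y} → x ≤ y → 0# ≤ y - x
  x≤y⇒0≤y-x {x} {y} x≤y = begin
    0#    ≈⟨ -‿inverseʳ x ⟨
    x - x ≤⟨ +-monoˡ-≤ (- x) x≤y ⟩
    y - x ∎

  0≤y-x⇒x≤y : ∀ {x y} → 0# ≤ y - x → x ≤ y
  0≤y-x⇒x≤y {x} {y} 0≤y-x = begin
    x           ≤⟨ x≤y+x 0≤y-x ⟩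
    (y - x) + x ≈⟨ [y-x]+x≈y x y ⟩
    y           ∎

  *-monoʳ-≤ : ∀ {x} → 0# ≤ x → ∀ {y z} → y ≤ z → x * y ≤ x * z
  *-monoʳ-≤ {x} 0≤x {y} {z} y≤z = 0≤y-x⇒x≤y (begin
    0#                ≤⟨ *-nonNeg 0≤x (x≤y⇒0≤y-x y≤z) ⟩
    x * (z - y)       ≈⟨ distribˡ x z (- y) ⟩
    x * z + x * (- y) ≈⟨ +-congˡ (-‿distribʳ-* x y) ⟨
    x * z - x * y     ∎)

  *-monoˡ-≤ : ∀ {x} → 0# ≤ x → ∀ {y z} → y ≤ z → y * x ≤ z * x
  *-monoˡ-≤ {x} 0≤x {y} {z} y≤z = begin
    y * x ≈⟨ *-comm y x ⟩
    x * y ≤⟨ *-monoʳ-≤ 0≤x y≤z ⟩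
    x * z ≈⟨ *-comm x z ⟩
    z * x ∎

  -- In the case `1# ≤ 0#`, the element `- 1#` is nonnegative and `1#` is its square.
  0≤1 : 0# ≤ 1#
  0≤1 with total 0# 1#
  ... | inj₁ 0≤1 = 0≤1
  ... | inj₂ 1≤0 = begin
    0#              ≤⟨ *-nonNeg 0≤-1 0≤-1 ⟩
    (- 1#) * (- 1#) ≈⟨ -‿distribˡ-* 1# (- 1#) ⟨
    - (1# * (- 1#)) ≈⟨ -‿distribʳ-* 1# (- 1#) ⟩
    1# * (- - 1#)   ≈⟨ *-identityˡ _ ⟩
    - - 1#          ≈⟨ -‿involutive 1# ⟩
    1#              ∎
    where
    0≤-1 : 0# ≤ - 1#
    0≤-1 = ≤-trans (x≤y⇒0≤y-x 1≤0) (≤-reflexive (+-identityˡ _))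

  0<1 : 0# < 1#
  0<1 = 0≤1 , 0≉1

  ι-nonNeg : ∀ n → 0# ≤ ι n
  ι-nonNeg zero    = ≤-refl
  ι-nonNeg (suc n) = +-nonNeg 0≤1 (ι-nonNeg n)

  ι-mono : ∀ {m n} → m ℕ.≤ n → ι m ≤ ι n
  ι-mono {n = n} z≤n = ι-nonNeg n
  ι-mono (s≤s m≤n)   = +-monoʳ-≤ 1# (ι-mono m≤n)

  ι-pos : ∀ n → 0# < ι (suc n)
  ι-pos n = <-≤-trans 0<1 (x≤x+y (ι-nonNeg n))

  ι2*x≈x+x : ∀ x → ι 2 * x ≈ x + x
  ι2*x≈x+x x = trans (distribʳ x 1# (ι 1))
    (+-cong (*-identityˡ x) (trans (*-congʳ (+-identityʳ 1#)) (*-identityˡ x)))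

  pos⇒≉0 : ∀ {x} → 0# < x → ¬ x ≈ 0#
  pos⇒≉0 (_ , 0≉x) x≈0 = 0≉x (sym x≈0)

  -- A nonpositive inverse would give `1# ≈ x * x ⁻¹ ≤ 0#`.
  ⁻¹-nonNeg : ∀ {x} → 0# < x → 0# ≤ x ⁻¹
  ⁻¹-nonNeg {x} 0<x with total 0# (x ⁻¹)
  ... | inj₁ 0≤x⁻¹ = 0≤x⁻¹
  ... | inj₂ x⁻¹≤0 = contradiction 1≤0 (<⇒≱ 0<1)
    where
    1≤0 : 1# ≤ 0#
    1≤0 = begin
      1#       ≈⟨ *-inverseʳ (pos⇒≉0 0<x) ⟨
      x * x ⁻¹ ≤⟨ *-monoʳ-≤ (proj₁ 0<x) x⁻¹≤0 ⟩
      x * 0#   ≈⟨ zeroʳ x ⟩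
      0#       ∎

  *-pos : ∀ {x y} → 0# < x → 0# < y → 0# < x * y
  *-pos {x} {y} 0<x 0<y = *-nonNeg (proj₁ 0<x) (proj₁ 0<y) , λ 0≈xy →
    pos⇒≉0 0<y (begin-equality
      y              ≈⟨ *-identityˡ y ⟨
      1# * y         ≈⟨ *-congʳ (trans (*-comm _ _) (*-inverseʳ (pos⇒≉0 0<x))) ⟨
      x ⁻¹ * x * y   ≈⟨ *-assoc _ x y ⟩
      x ⁻¹ * (x * y) ≈⟨ *-congˡ 0≈xy ⟨
      x ⁻¹ * 0#      ≈⟨ zeroʳ _ ⟩
      0#             ∎)

  ^-pos : ∀ {x} → 0# < x → ∀ n → 0# < x ^ n
  ^-pos 0<x zero    = 0<1
  ^-pos 0<x (suc n) = *-pos 0<x (^-pos 0<x n)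

  1≤x^n : ∀ {x} → 1# ≤ x → ∀ n → 1# ≤ x ^ n
  1≤x^n 1≤x zero = ≤-refl
  1≤x^n {x} 1≤x (suc n) = begin
    1#        ≤⟨ 1≤x^n 1≤x n ⟩
    x ^ n      ≈⟨ *-identityˡ _ ⟨
    1# * x ^ n ≤⟨ *-monoˡ-≤ (≤-trans 0≤1 (1≤x^n 1≤x n)) 1≤x ⟩
    x * x ^ n  ∎

  x*[x⁻¹*y]≈y : ∀ {x} → 0# < x → ∀ y → x * (x ⁻¹ * y) ≈ y
  x*[x⁻¹*y]≈y 0<x y =
    trans (sym (*-assoc _ _ y)) (trans (*-congʳ (*-inverseʳ (pos⇒≉0 0<x))) (*-identityˡ y))

  x⁻¹*[x*y]≈y : ∀ {x} → 0# < x → ∀ y → x ⁻¹ * (x * y) ≈ y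
  x⁻¹*[x*y]≈y 0<x y = trans (*-x∙yz≈y∙xz _ _ y) (x*[x⁻¹*y]≈y 0<x y)

  y≤x*z⇒x⁻¹*y≤z : ∀ {x} → 0# < x → ∀ {y z} → y ≤ x * z → x ⁻¹ * y ≤ z
  y≤x*z⇒x⁻¹*y≤z 0<x y≤xz =
    ≤-trans (*-monoʳ-≤ (⁻¹-nonNeg 0<x) y≤xz) (≤-reflexive (x⁻¹*[x*y]≈y 0<x _))

  x⁻¹*y≤z⇒y≤x*z : ∀ {x} → 0# < x → ∀ {y z} → x ⁻¹ * y ≤ z → y ≤ x * z
  x⁻¹*y≤z⇒y≤x*z 0<x x⁻¹y≤z =
    ≤-trans (≤-reflexive (sym (x*[x⁻¹*y]≈y 0<x _))) (*-monoʳ-≤ (proj₁ 0<x) x⁻¹y≤z)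

  sum-mono-≤ : ∀ {n} {u v : Vector Carrier n} → (∀ i → u i ≤ v i) → sum u ≤ sum v
  sum-mono-≤ {zero}  u≤v = ≤-refl
  sum-mono-≤ {suc n} u≤v = +-mono-≤ (u≤v zero) (sum-mono-≤ (u≤v ∘ suc))

  sum-nonNeg : ∀ {n} {v : Vector Carrier n} → (∀ i → 0# ≤ v i) → 0# ≤ sum v
  sum-nonNeg {zero}  0≤v = ≤-refl
  sum-nonNeg {suc n} 0≤v = +-nonNeg (0≤v zero) (sum-nonNeg (0≤v ∘ suc))

does≡true⇒ : ∀ {p} {P : Set p} (P? : Dec P) → does P? ≡ true → P
does≡true⇒ (yes p) _ = p

-- Lets each branch of an `if does P?` use the proof or refutation behind the Boolean; the nested
-- tests of the loop body are split this way.
if-dec : ∀ {a b p} {A : Set a} {P : Set p} (Q : A → Set b) (P? : Dec P) {x y : A} →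
         (P → Q x) → (¬ P → Q y) → Q (if does P? then x else y)
if-dec Q (yes p) q _ = q p
if-dec Q (no ¬p) _ q = q ¬p

-- Suffix sums and summation by parts.

module SuffixSums {c ℓ₁ ℓ₂} (F : OrderedField c ℓ₁ ℓ₂) where
  open OrderedFieldProperties F

  suffixSum : ∀ {n} → Vector Carrier n → Fin n → Carrier
  suffixSum v zero    = sum v
  suffixSum v (suc i) = suffixSum (v ∘ suc) i

  suffixSum-updateAt : ∀ {n} (v : Vector Carrier n) {f} i j → i Fin.< j →
                       suffixSum (updateAt v i f) j ≡ suffixSum v j
  suffixSum-updateAt v zero    (suc j) _         = refl
  suffixSum-updateAt v (suc i) (suc j) (s≤s i<j) = suffixSum-updateAt (v ∘ suc) i j i<j

  -- The loop fills `R̂` from the top down, so at the current index everything below is still zero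
  -- and the suffix sum is the running total.
  suffixSum≈sum : ∀ {n} (v : Vector Carrier n) i → (∀ j → j Fin.< i → v j ≡ 0#) →
                  suffixSum v i ≈ sum v
  suffixSum≈sum v zero    _  = ≈-refl
  suffixSum≈sum v (suc i) v0 = trans
    (suffixSum≈sum (v ∘ suc) i (λ j j<i → v0 (suc j) (s≤s j<i)))
    (sym (trans (+-congʳ (reflexive (v0 zero (s≤s z≤n)))) (+-identityˡ _)))

  sum-updateAt : ∀ {n} (v : Vector Carrier n) i x → v i ≡ 0# →
                 sum (updateAt v i (const x)) ≈ x + sum v
  sum-updateAt v zero    x v0 =
    +-congˡ (sym (trans (+-congʳ (reflexive v0)) (+-identityˡ _)))
  sum-updateAt v (suc i) x vi =
    trans (+-congˡ (sum-updateAt (v ∘ suc) i x vi)) (+-x∙yz≈y∙xz _ x _)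

  -- The gaps of the sequence 0, r₀, r₁, … .
  gap : ℕ → Carrier
  gap zero    = 1#
  gap (suc i) = r F i

  0,r : ℕ → Carrier
  0,r zero    = 0#
  0,r (suc i) = r F i

  0,r+gap : ∀ i → 0,r i + gap i ≈ r F i
  0,r+gap zero    = +-identityˡ 1#
  0,r+gap (suc i) = sym (ι2*x≈x+x _)

  r-pos : ∀ i → 0# < r F i
  r-pos = ^-pos (ι-pos 1)

  gap-nonNeg : ∀ i → 0# ≤ gap i
  gap-nonNeg zero    = 0≤1
  gap-nonNeg (suc i) = proj₁ (r-pos i)

  r-mono : ∀ {i j} → i ℕ.≤ j → r F i ≤ r F j
  r-mono {j = j} z≤n = 1≤x^n (x≤x+y (ι-nonNeg 1)) j
  r-mono (s≤s i≤j)   = *-monoʳ-≤ (ι-nonNeg 2) (r-mono i≤j)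

  -- The offset `a` and the boundary term `0,r a * sum v` carry the induction: passing to the tail
  -- raises the offset by one, and `r F a` splits into `0,r a + gap a`.
  summation-by-parts : ∀ {n} a (v : Vector Carrier n) →
    sum (λ i → r F (a ℕ.+ toℕ i) * v i) ≈
    0,r a * sum v + sum (λ i → gap (a ℕ.+ toℕ i) * suffixSum v i)
  summation-by-parts {zero} a v = sym (trans (+-identityʳ _) (zeroʳ _))
  summation-by-parts {suc n} a v rewrite ℕ.+-identityʳ a = begin-equality
    r F a * v zero + sum (λ i → r F (a ℕ.+ suc (toℕ i)) * v (suc i))
      ≈⟨ +-congˡ (sum-cong-≋ {n} λ i → *-congʳ (reflexive (≡.cong (r F) (ℕ.+-suc a (toℕ i))))) ⟩
    r F a * v zero + sum (λ i → r F (suc a ℕ.+ toℕ i) * v (suc i))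
      ≈⟨ +-congˡ (summation-by-parts (suc a) (v ∘ suc)) ⟩
    r F a * v zero + (r F a * sum (v ∘ suc) + rest)
      ≈⟨ +-assoc _ _ _ ⟨
    r F a * v zero + r F a * sum (v ∘ suc) + rest
      ≈⟨ +-congʳ (distribˡ _ _ _) ⟨
    r F a * sum v + rest
      ≈⟨ +-congʳ (*-congʳ (0,r+gap a)) ⟨
    (0,r a + gap a) * sum v + rest
      ≈⟨ +-congʳ (distribʳ _ _ _) ⟩
    0,r a * sum v + gap a * sum v + rest
      ≈⟨ +-assoc _ _ _ ⟩
    0,r a * sum v + (gap a * sum v + rest)
      ≈⟨ +-congˡ (+-congˡ (sum-cong-≋ {n} λ i → *-congʳ (reflexive (≡.cong gap (ℕ.+-suc a (toℕ i)))))) ⟨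
    0,r a * sum v + (gap a * sum v + sum (λ i → gap (a ℕ.+ suc (toℕ i)) * suffixSum (v ∘ suc) i)) ∎
    where rest = sum (λ i → gap (suc a ℕ.+ toℕ i) * suffixSum (v ∘ suc) i)

  ∑r*v≈∑gap*suffixSum : ∀ {n} (v : Vector Carrier n) →
    sum (λ i → r F (toℕ i) * v i) ≈ sum (λ i → gap (toℕ i) * suffixSum v i)
  ∑r*v≈∑gap*suffixSum v = trans (summation-by-parts 0 v)
    (trans (+-congʳ (zeroˡ _)) (+-identityˡ _))

  -- Recovering a weight, up to a factor 2, from the gaps below it.

  indicator : ∀ {p} {P : Set p} → Dec P → Carrier
  indicator P? = if does P? then 1# else 0#

  indicator-nonNeg : ∀ {p} {P : Set p} (P? : Dec P) → 0# ≤ indicator P?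
  indicator-nonNeg (yes _) = 0≤1
  indicator-nonNeg (no _)  = ≤-refl

  -- For a = 0 and x in class j < n this telescopes to r j.
  gapsBelow : ℕ → ℕ → Carrier → Carrier
  gapsBelow n a x = sum {n} λ i → gap (a ℕ.+ toℕ i) * indicator (r F (a ℕ.+ toℕ i) ≤? x)

  gapsBelow-nonNeg : ∀ n a x → 0# ≤ gapsBelow n a x
  gapsBelow-nonNeg n a x = sum-nonNeg {n} λ i →
    *-nonNeg (gap-nonNeg (a ℕ.+ toℕ i)) (indicator-nonNeg (r F (a ℕ.+ toℕ i) ≤? x))

  gapsBelow-suc : ∀ n a x → gapsBelow (suc n) a x ≈
                  gap a * indicator (r F a ≤? x) + gapsBelow n (suc a) x
  gapsBelow-suc n a x rewrite ℕ.+-identityʳ a =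
    +-congˡ (sum-cong-≋ {n} λ i → reflexive
      (≡.cong (λ k → gap k * indicator (r F k ≤? x)) (ℕ.+-suc a (toℕ i))))

  -- As `r F` is monotone, every later threshold exceeds `x` too and all indicators vanish.
  gapsBelow-none : ∀ n a {x} → x < r F a → gapsBelow n a x ≈ 0#
  gapsBelow-none n a {x} x<ra = trans (sum-cong-≋ {n} vanishes) (sum-replicate-zero n)
    where
    vanishes : ∀ (i : Fin n) → gap (a ℕ.+ toℕ i) * indicator (r F (a ℕ.+ toℕ i) ≤? x) ≈ 0#
    vanishes i with r F (a ℕ.+ toℕ i) ≤? x
    ... | yes r≤x = contradiction (≤-trans (r-mono (ℕ.m≤m+n a (toℕ i))) r≤x) (<⇒≱ x<ra)
    ... | no _    = zeroʳ _

  -- One step of the telescoping: the first gap lifts the collected amount from `0,r a` to `r F a`,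
  -- which is `0,r (suc a)`.
  gapsBelow-step : ∀ n a {x} → r F a ≤ x → 0,r a + gapsBelow (suc n) a x ≈ r F a + gapsBelow n (suc a) x
  gapsBelow-step n a {x} ra≤x = begin-equality
    0,r a + gapsBelow (suc n) a x                ≈⟨ +-congˡ (gapsBelow-suc n a x) ⟩
    0,r a + (gap a * indicator (r F a ≤? x) + _) ≈⟨ +-assoc _ _ _ ⟨
    0,r a + gap a * indicator (r F a ≤? x) + _   ≈⟨ +-congʳ (+-congˡ gap*1) ⟩
    0,r a + gap a + _                            ≈⟨ +-congʳ (0,r+gap a) ⟩
    r F a + gapsBelow n (suc a) x                ∎
    where
    gap*1 : gap a * indicator (r F a ≤? x) ≈ gap a
    gap*1 with r F a ≤? x
    ... | yes _    = *-identityʳ _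
    ... | no ra≰x = contradiction ra≤x ra≰x

  -- The collected amount is always a threshold not above `x`; it climbs until the next threshold
  -- exceeds `x`, after which no gap is left, or until the range ends.
  gapsBelow-lower : ∀ n a {x} → 0,r a ≤ x → 0,r a + gapsBelow n a x ≤ x
  gapsBelow-lower zero    a {x} pa≤x = ≤-trans (≤-reflexive (+-identityʳ _)) pa≤x
  gapsBelow-lower (suc n) a {x} pa≤x with r F a ≤? x
  ... | yes ra≤x = ≤-trans (≤-reflexive (gapsBelow-step n a ra≤x)) (gapsBelow-lower n (suc a) ra≤x)
  ... | no  ra≰x = ≤-trans (≤-reflexive
                     (trans (+-congˡ (gapsBelow-none (suc n) a (≰⇒> ra≰x))) (+-identityʳ _))) pa≤x

  -- The climb reaches the largest threshold not above `x`, and `x` is less than the next one, which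
  -- is twice as large. The second hypothesis guarantees that the climb is not cut off by the end of
  -- the range.
  gapsBelow-upper : ∀ n a {x} → r F a ≤ x → x < r F (suc a ℕ.+ n) →
                    x ≤ ι 2 * (r F a + gapsBelow n (suc a) x)
  gapsBelow-upper zero a {x} ra≤x x<r = begin
    x                     ≤⟨ proj₁ x<r ⟩
    r F (suc a ℕ.+ 0)     ≡⟨ ≡.cong (r F ∘ suc) (ℕ.+-identityʳ a) ⟩
    ι 2 * r F a           ≈⟨ *-congˡ (+-identityʳ _) ⟨
    ι 2 * (r F a + 0#)    ∎
  gapsBelow-upper (suc n) a {x} ra≤x x<r with r F (suc a) ≤? x
  ... | yes rsa≤x = begin
    x ≤⟨ gapsBelow-upper n (suc a) rsa≤x (≡.subst (λ k → x < r F k) (ℕ.+-suc (suc a) n) x<r) ⟩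
    ι 2 * (r F (suc a) + gapsBelow n (suc (suc a)) x) ≈⟨ *-congˡ (gapsBelow-step n (suc a) rsa≤x) ⟨
    ι 2 * (r F a + gapsBelow (suc n) (suc a) x) ∎
  ... | no rsa≰x = begin
    x ≤⟨ proj₁ (≰⇒> rsa≰x) ⟩
    ι 2 * r F a ≤⟨ *-monoʳ-≤ (ι-nonNeg 2) (x≤x+y (gapsBelow-nonNeg (suc n) (suc a) x)) ⟩
    ι 2 * (r F a + gapsBelow (suc n) (suc a) x) ∎

  gapsBelow≤x : ∀ n {x} → 0# ≤ x → gapsBelow n 0 x ≤ x
  gapsBelow≤x n 0≤x = ≤-trans (≤-reflexive (sym (+-identityˡ _))) (gapsBelow-lower n 0 0≤x)

  x≤2*gapsBelow : ∀ n {x} → 1# ≤ x → x < r F (suc n) → x ≤ ι 2 * gapsBelow (suc n) 0 x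
  x≤2*gapsBelow n {x} 1≤x x<r = ≤-trans (gapsBelow-upper n 0 1≤x x<r) (≤-reflexive (*-congˡ
    (trans (sym (gapsBelow-step n 0 1≤x)) (+-identityˡ _))))

  -- Double counting of the pairs of an edge and a threshold not above its weight.
  weightedCounts : ∀ {a} {E : Set a} (n : ℕ) (w : E → Carrier) (M : List E) →
    sum {n} (λ i → gap (toℕ i) * ι (length (filter (λ e → r F (toℕ i) ≤? w e) M))) ≈
    List.foldr (λ e x → gapsBelow n 0 (w e) + x) 0# M
  weightedCounts n w []      = trans (sum-cong-≋ {n} λ i → zeroʳ _) (sum-replicate-zero n)
  weightedCounts n w (e ∷ M) = begin-equality
    sum {n} (λ i → gap (toℕ i) * ι (count i (e ∷ M)))
      ≈⟨ sum-cong-≋ {n} split ⟩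
    sum {n} (λ i → gap (toℕ i) * indicator (r F (toℕ i) ≤? w e) + gap (toℕ i) * ι (count i M))
      ≈⟨ ∑-distrib-+ {n} _ _ ⟩
    gapsBelow n 0 (w e) + sum {n} (λ i → gap (toℕ i) * ι (count i M))
      ≈⟨ +-congˡ (weightedCounts n w M) ⟩
    gapsBelow n 0 (w e) + _ ∎
    where
    count : Fin n → List _ → ℕ
    count i M = length (filter (λ e → r F (toℕ i) ≤? w e) M)
    split : ∀ i → gap (toℕ i) * ι (count i (e ∷ M)) ≈
                  gap (toℕ i) * indicator (r F (toℕ i) ≤? w e) + gap (toℕ i) * ι (count i M)
    split i with r F (toℕ i) ≤? w e
    ... | yes _ = distribˡ _ _ _
    ... | no  _ = sym (trans (+-congʳ (zeroʳ _)) (+-identityˡ _))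

-- The loop invariant of the evaluation for `T = 1`, `κ = 0`.

module EvaluationProperties {c ℓ₁ ℓ₂} (F : OrderedField c ℓ₁ ℓ₂)
  {t : ℕ} (M̂ : Vector (OrderedField.Carrier F) (suc t)) where
  open OrderedFieldProperties F
  open SuffixSums F
  open Evaluation F 1# 0# M̂

  -- The state after the indices ≥ k have been processed.
  record Processed (k : ℕ) (ρ : Registers F t) : Set (c ⊔ ℓ₁ ⊔ ℓ₂) where
    open Registers ρ
    field
      last≥k   : k ℕ.≤ toℕ last
      Ŝ-last   : Ŝ last ≡ M̂ last
      R̂-below  : ∀ i → toℕ i ℕ.< k → R̂ i ≡ 0#
      ∑R̂       : sum R̂ ≈ M̂ last
      attained : ∀ i → k ℕ.≤ toℕ i → ∃[ j ] i Fin.≤ j × suffixSum R̂ i ≈ M̂ j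
      bounds   : ∀ i → k ℕ.≤ toℕ i → M̂ i ≤ suffixSum R̂ i

  open Processed

  start-processed : Processed t start
  start-processed = record
    { last≥k = ℕ.≤-reflexive (≡.sym (Fin.toℕ-fromℕ t))
    ; Ŝ-last = updateAt-updates top _
    ; R̂-below = λ i i<t → updateAt-minimal i top _ λ { refl → ℕ.<-irrefl (Fin.toℕ-fromℕ t) i<t }
    ; ∑R̂ = ∑
    ; attained = λ i t≤i → top , Fin.≤fromℕ i , top-sum i t≤i
    ; bounds = λ i t≤i →
        ≤-reflexive (trans (reflexive (≡.cong M̂ (i≡top t≤i))) (sym (top-sum i t≤i)))
    }
    where
    top = fromℕ t
    i≡top : ∀ {i : Fin (suc t)} → t ℕ.≤ toℕ i → i ≡ top
    i≡top {i} t≤i = Fin.≤-antisym (Fin.≤fromℕ i) (≡.subst (ℕ._≤ toℕ i) (≡.sym (Fin.toℕ-fromℕ t)) t≤i)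
    ∑ : sum (Registers.R̂ start) ≈ M̂ top
    ∑ = trans (sum-updateAt (replicate (suc t) 0#) top _ refl)
              (trans (+-congˡ (sum-replicate-zero (suc t))) (+-identityʳ _))
    top-sum : ∀ i → t ℕ.≤ toℕ i → suffixSum (Registers.R̂ start) i ≈ M̂ top
    top-sum i t≤i = trans (suffixSum≈sum _ i λ j j<i → updateAt-minimal j top _
      λ { refl → ℕ.<⇒≱ j<i (Fin.≤fromℕ i) }) ∑

  -- Clearing or recording Ŝ i without touching R̂ is harmless since last ≠ i.
  reject : ∀ {i x} ρ → Processed (suc (toℕ i)) ρ → let open Registers ρ in
           M̂ i ≤ M̂ last → Processed (toℕ i) (registers (Ŝ [ i ≔ x ]) R̂ last)
  reject {i} {x} (registers Ŝ R̂ last) inv M̂i≤ = record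
    { last≥k = ℕ.<⇒≤ (last≥k inv)
    ; Ŝ-last = ≡.trans (updateAt-minimal last i Ŝ λ { refl → ℕ.<-irrefl refl (last≥k inv) }) (Ŝ-last inv)
    ; R̂-below = λ j j<i → R̂-below inv j (ℕ.m<n⇒m<1+n j<i)
    ; ∑R̂ = ∑R̂ inv
    ; attained = att
    ; bounds = bnd
    }
    where
    -- Below `i` the array is still zero, so the suffix sum at `i` is the whole sum, the estimate at
    -- the unchanged `last`.
    at-i : suffixSum R̂ i ≈ M̂ last
    at-i = trans (suffixSum≈sum R̂ i λ j j<i → R̂-below inv j (ℕ.m<n⇒m<1+n j<i)) (∑R̂ inv)
    att : ∀ j → toℕ i ℕ.≤ toℕ j → ∃[ l ] j Fin.≤ l × suffixSum R̂ j ≈ M̂ l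
    att j i≤j with i Fin.≟ j
    ... | yes refl = last , ℕ.<⇒≤ (last≥k inv) , at-i
    ... | no i≢j = attained inv j (Fin.≤∧≢⇒< i≤j i≢j)
    bnd : ∀ j → toℕ i ℕ.≤ toℕ j → M̂ j ≤ suffixSum R̂ j
    bnd j i≤j with i Fin.≟ j
    ... | yes refl = ≤-trans M̂i≤ (≤-reflexive (sym at-i))
    ... | no i≢j = bounds inv j (Fin.≤∧≢⇒< i≤j i≢j)

  -- The earlier entries sum to `M̂ last`, which is `Ŝ last`, so adding the increment
  -- `M̂ i - Ŝ last` telescopes the total to `M̂ i`. Suffix sums above `i` are untouched.
  accept : ∀ {i} ρ → Processed (suc (toℕ i)) ρ → let open Registers ρ in
           Processed (toℕ i) (registers (Ŝ [ i ≔ M̂ i ]) (R̂ [ i ≔ M̂ i - Ŝ last ]) i)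
  accept {i} (registers Ŝ R̂ last) inv = record
    { last≥k = ℕ.≤-refl
    ; Ŝ-last = updateAt-updates i Ŝ
    ; R̂-below = below
    ; ∑R̂ = ∑
    ; attained = att
    ; bounds = bnd
    }
    where
    R̂′ = R̂ [ i ≔ M̂ i - Ŝ last ]
    below : ∀ j → toℕ j ℕ.< toℕ i → R̂′ j ≡ 0#
    below j j<i = ≡.trans (updateAt-minimal j i R̂ λ { refl → ℕ.<-irrefl refl j<i })
                          (R̂-below inv j (ℕ.m<n⇒m<1+n j<i))
    ∑ : sum R̂′ ≈ M̂ i
    ∑ = begin-equality
      sum R̂′                         ≈⟨ sum-updateAt R̂ i _ (R̂-below inv i ℕ.≤-refl) ⟩
      (M̂ i - Ŝ last) + sum R̂        ≈⟨ +-congˡ (trans (∑R̂ inv) (reflexive (≡.sym (Ŝ-last inv)))) ⟩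
      (M̂ i - Ŝ last) + Ŝ last       ≈⟨ [y-x]+x≈y _ _ ⟩
      M̂ i                            ∎
    at-i : suffixSum R̂′ i ≈ M̂ i
    at-i = trans (suffixSum≈sum R̂′ i below) ∑
    after : ∀ j → i Fin.< j → suffixSum R̂′ j ≡ suffixSum R̂ j
    after = suffixSum-updateAt R̂ i
    att : ∀ j → toℕ i ℕ.≤ toℕ j → ∃[ l ] j Fin.≤ l × suffixSum R̂′ j ≈ M̂ l
    att j i≤j with i Fin.≟ j
    ... | yes refl = i , ℕ.≤-refl , at-i
    ... | no i≢j rewrite after j (Fin.≤∧≢⇒< i≤j i≢j) = attained inv j (Fin.≤∧≢⇒< i≤j i≢j)
    bnd : ∀ j → toℕ i ℕ.≤ toℕ j → M̂ j ≤ suffixSum R̂′ j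
    bnd j i≤j with i Fin.≟ j
    ... | yes refl = ≤-reflexive (sym at-i)
    ... | no i≢j rewrite after j (Fin.≤∧≢⇒< i≤j i≢j) = bounds inv j (Fin.≤∧≢⇒< i≤j i≢j)

  -- Failure of either test yields the inequality `M̂ i ≤ M̂ last` that `reject` asks for: the first
  -- directly because `T` is 1, the second because with `κ` equal to 0 it bounds the increment above
  -- by 0.
  body-processed : ∀ i ρ → Processed (suc (toℕ i)) ρ → Processed (toℕ i) (body i ρ)
  body-processed i ρ@(registers Ŝ R̂ last) inv =
    if-dec (Processed (toℕ i)) (1# * Ŝ last <? M̂ i)
      (λ _ → if-dec (Processed (toℕ i)) (0# * R̂ last ≤? M̂ i - Ŝ last)
        (λ _ → accept ρ inv)
        (λ ≰ → reject ρ inv (begin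
          M̂ i                      ≈⟨ [y-x]+x≈y _ _ ⟨
          (M̂ i - Ŝ last) + Ŝ last ≤⟨ +-monoˡ-≤ _ (proj₁ (≰⇒> ≰)) ⟩
          0# * R̂ last + Ŝ last    ≈⟨ trans (+-congʳ (zeroˡ _)) (+-identityˡ _) ⟩
          Ŝ last                   ≡⟨ Ŝ-last inv ⟩
          M̂ last                   ∎)))
      (λ ≮ → reject ρ inv (begin
        M̂ i          ≤⟨ ≮⇒≥ ≮ ⟩
        1# * Ŝ last  ≈⟨ *-identityˡ _ ⟩
        Ŝ last       ≡⟨ Ŝ-last inv ⟩
        M̂ last       ∎))

  -- Generalises `allFin t` to its tails: `f` lists `k`, `k + 1`, ..., `t - 1`, and the right fold
  -- treats `k` last.
  foldr-processed : ∀ m k (f : Fin m → Fin t) → (∀ x → toℕ (f x) ≡ k ℕ.+ toℕ x) → k ℕ.+ m ≡ t →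
                    Processed k (List.foldr (body ∘ inject₁) start (tabulate f))
  foldr-processed zero k f f≡ k+m≡t =
    ≡.subst (λ k → Processed k start) (≡.trans (≡.sym k+m≡t) (ℕ.+-identityʳ k)) start-processed
  foldr-processed (suc m) k f f≡ k+m≡t =
    ≡.subst (λ j → Processed j (body (inject₁ (f zero)) ρ)) i≡k
      (body-processed (inject₁ (f zero)) ρ (≡.subst (λ j → Processed j ρ) (≡.cong suc (≡.sym i≡k))
        (foldr-processed m (suc k) (f ∘ suc)
          (λ x → ≡.trans (f≡ (suc x)) (ℕ.+-suc k (toℕ x)))
          (≡.trans (≡.sym (ℕ.+-suc k m)) k+m≡t))))
    where
    ρ = List.foldr (body ∘ inject₁) start (tabulate (f ∘ suc))
    i≡k : toℕ (inject₁ (f zero)) ≡ k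
    i≡k = ≡.trans (Fin.toℕ-inject₁ (f zero)) (≡.trans (f≡ zero) (ℕ.+-identityʳ k))

  end-processed : Processed 0 end
  end-processed = foldr-processed t 0 id (λ _ → refl) refl

-- Vertex covers and domination bound the size of a matching.

module _ {n : ℕ} where

  disjoint? : (e f : Edge n) → Dec (Disjoint e f)
  disjoint? (edge u v _) (edge u′ v′ _) =
    ¬? (u Fin.≟ u′) ×-dec ¬? (u Fin.≟ v′) ×-dec ¬? (v Fin.≟ u′) ×-dec ¬? (v Fin.≟ v′)

  infix 4 _∈ᴱ_
  _∈ᴱ_ : Fin n → Edge n → Set
  v ∈ᴱ e = v ≡ Edge.lo e ⊎ v ≡ Edge.hi e

  disjoint⇒∉ : ∀ e f {v} → Disjoint e f → v ∈ᴱ e → ¬ v ∈ᴱ f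
  disjoint⇒∉ _ _ (≢ , _) (inj₁ refl) (inj₁ eq) = ≢ eq
  disjoint⇒∉ _ _ (_ , ≢ , _) (inj₁ refl) (inj₂ eq) = ≢ eq
  disjoint⇒∉ _ _ (_ , _ , ≢ , _) (inj₂ refl) (inj₁ eq) = ≢ eq
  disjoint⇒∉ _ _ (_ , _ , _ , ≢) (inj₂ refl) (inj₂ eq) = ≢ eq

  ¬disjoint⇒common : ∀ e f → ¬ Disjoint e f → ∃[ v ] v ∈ᴱ e × v ∈ᴱ f
  ¬disjoint⇒common (edge u v _) (edge u′ v′ _) ¬d
    with u Fin.≟ u′ | u Fin.≟ v′ | v Fin.≟ u′ | v Fin.≟ v′
  ... | yes eq | _ | _ | _ = u , inj₁ refl , inj₁ eq
  ... | no _ | yes eq | _ | _ = u , inj₁ refl , inj₂ eq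
  ... | no _ | no _ | yes eq | _ = v , inj₂ refl , inj₁ eq
  ... | no _ | no _ | no _ | yes eq = v , inj₂ refl , inj₂ eq
  ... | no p | no q | no r | no s = contradiction (p , q , r , s) ¬d

  ¬disjoint-refl : ∀ e → ¬ Disjoint e e
  ¬disjoint-refl e d = disjoint⇒∉ e e d (inj₁ refl) (inj₁ refl)

  Covers : List (Fin n) → Edge n → Set
  Covers vs e = ∃[ v ] v ∈ᴱ e × v ∈ vs

  ∈-─⁺ : ∀ {vs : List (Fin n)} {v w} (p : v ∈ vs) → w ∈ vs → w ≢ v → w ∈ (vs ─ p)
  ∈-─⁺ (here refl) (here w≡v) w≢v = contradiction w≡v w≢v
  ∈-─⁺ (here refl) (there q)  _   = q
  ∈-─⁺ (there p)   (here eq)  _   = here eq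
  ∈-─⁺ (there p)   (there q)  w≢v = there (∈-─⁺ p q w≢v)

  -- Disjoint edges use different cover vertices: once the vertex covering `e` is removed, the rest
  -- of `vs` still covers the rest of `M`.
  length≤cover : ∀ {M vs} → AllPairs Disjoint M → All (Covers vs) M → length M ℕ.≤ length vs
  length≤cover [] [] = z≤n
  length≤cover {e ∷ M} {vs} (de ∷ dM) ((v , v∈e , v∈vs) ∷ cM) =
    ≡.subst (suc (length M) ℕ.≤_) (≡.sym (length-removeAt′ vs (index v∈vs)))
      (s≤s (length≤cover dM (All.zipWith (λ {f} → avoid {f}) (de , cM))))
    where
    avoid : ∀ {f} → Disjoint e f × Covers vs f → Covers (vs ─ v∈vs) f
    avoid {f} (d , w , w∈f , w∈vs) = w , w∈f , ∈-─⁺ v∈vs w∈vs λ { refl → disjoint⇒∉ e f d v∈e w∈f }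

  endpoints : List (Edge n) → List (Fin n)
  endpoints []      = []
  endpoints (f ∷ N) = Edge.lo f ∷ Edge.hi f ∷ endpoints N

  length-endpoints : ∀ N → length (endpoints N) ≡ 2 ℕ.* length N
  length-endpoints []      = refl
  length-endpoints (f ∷ N) rewrite length-endpoints N | ℕ.+-suc (length N) (length N ℕ.+ 0) = refl

  -- Meeting an edge of `N` includes belonging to `N`, since no edge is `Disjoint` from itself.
  Dominates : List (Edge n) → Edge n → Set
  Dominates N e = Any (λ f → ¬ Disjoint e f) N

  endpoints-cover : ∀ e {N} → Dominates N e → Covers (endpoints N) e
  endpoints-cover e {f ∷ _} (here ¬d) with ¬disjoint⇒common e f ¬d
  ... | v , v∈e , inj₁ eq = v , v∈e , here eq
  ... | v , v∈e , inj₂ eq = v , v∈e , there (here eq)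
  endpoints-cover e (there p) with endpoints-cover e p
  ... | v , v∈e , q = v , v∈e , there (there q)

  -- The endpoints of `N`, two for each edge, form a vertex cover of `M`.
  length≤2*dominating : ∀ {M N} → AllPairs Disjoint M → All (Dominates N) M →
                        length M ℕ.≤ 2 ℕ.* length N
  length≤2*dominating {M} {N} dM domM =
    ≡.subst (length M ℕ.≤_) (length-endpoints N) (length≤cover dM (All.map (λ {e} → endpoints-cover e) domM))

  matching-length≤n : ∀ {M : List (Edge n)} → AllPairs Disjoint M → length M ℕ.≤ n
  matching-length≤n {M} dM = ≡.subst (length M ℕ.≤_) (length-tabulate id)
    (length≤cover dM (All.universal (λ e → Edge.lo e , inj₁ refl , ∈-allFin _) M))

  -- Exhaustive search for a maximum matching.

  edgesBetween : Fin n → Fin n → List (Edge n)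
  edgesBetween u v with u Fin.<? v
  ... | yes u<v = edge u v u<v ∷ []
  ... | no _    = []

  ∈-edgesBetween : ∀ e → e ∈ edgesBetween (Edge.lo e) (Edge.hi e)
  ∈-edgesBetween (edge u v u<v) with u Fin.<? v
  ... | yes _   = here refl
  ... | no  u≮v = contradiction-irr u<v u≮v

  allEdges : List (Edge n)
  allEdges = concatMap (λ u → concatMap (edgesBetween u) (allFin n)) (allFin n)

  ∈-allEdges : ∀ e → e ∈ allEdges
  ∈-allEdges e = ∈-concatMap⁺ _ (lose (∈-allFin (Edge.lo e))
    (∈-concatMap⁺ _ (lose (∈-allFin (Edge.hi e)) (∈-edgesBetween e))))

  -- There are finitely many edges, so each choice of a first edge is tried in turn, with the
  -- predicate specialised to lists starting with it.
  ∃length? : ∀ {p} {P : Pred (List (Edge n)) p} → Decidable P →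
             ∀ k → Dec (∃[ M ] length M ≡ k × P M)
  ∃length? P? zero = map′ (λ p → [] , refl , p) (λ { ([] , _ , p) → p }) (P? [])
  ∃length? {P = P} P? (suc k) = map′ to from (any? (λ e → ∃length? (P? ∘ (e ∷_)) k) allEdges)
    where
    to : Any (λ e → ∃[ M ] length M ≡ k × P (e ∷ M)) allEdges → ∃[ M ] length M ≡ suc k × P M
    to a = let (e , _ , M , l , p) = find a in e ∷ M , ≡.cong suc l , p
    from : ∃[ M ] length M ≡ suc k × P M → Any (λ e → ∃[ M ] length M ≡ k × P (e ∷ M)) allEdges
    from (e ∷ M , l , p) = lose (∈-allEdges e) (M , ℕ.suc-injective l , p)

  isEdge? : ∀ {a} {L : Set a} (G : Graph L n) → Decidable (Is-just ∘ G)
  isEdge? G e = MaybeAny.dec (λ _ → yes tt) (G e)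

  isMatching? : ∀ {a} {L : Set a} (G : Graph L n) → Decidable (IsMatching G)
  isMatching? G M = map′ (λ (e , d) → record { edges = e ; disjoint = d })
    (λ m → IsMatching.edges m , IsMatching.disjoint m)
    (All.all? (isEdge? G) M ×-dec AllPairs.allPairs? disjoint? M)

  -- No matching has more than `n` edges, so the search runs through the lengths downwards from `n`;
  -- the first length attained is maximal.
  maximumMatching : ∀ {a} {L : Set a} (G : Graph L n) → ∃[ M ] IsMaximumMatching G M
  maximumMatching G = search n λ M m → matching-length≤n (IsMatching.disjoint m)
    where
    search : ∀ k → (∀ M → IsMatching G M → length M ℕ.≤ k) → ∃[ M ] IsMaximumMatching G M
    search k bound with ∃length? (isMatching? G) k
    ... | yes (M , refl , m) = M , record { isMatching = m ; maximum = bound }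
    -- Length 0 is always attained, by the empty matching.
    search zero bound | no ∄M = contradiction ([] , refl , record { edges = [] ; disjoint = [] }) ∄M
    search (suc k) bound | no ∄M = search k λ M m →
      ℕ.≤-pred (ℕ.≤∧≢⇒< (bound M m) λ l → ∄M (M , l , m))


-- The greedy matching, heaviest edges first.

module GreedyMatching {n o ℓ₁ ℓ₂} (O : DecTotalOrder o ℓ₁ ℓ₂) (w : Edge n → DecTotalOrder.Carrier O) where
  open DecTotalOrder O using (_≤_) renaming (refl to ≤-refl; trans to ≤-trans)
  byWeight = On.decTotalOrder O w
  open Sort byWeight using (sort; sort-↭; sort-↗)

  DominatesFromAbove : List (Edge n) → Edge n → Set ℓ₂
  DominatesFromAbove N e = Any (λ f → w e ≤ w f × ¬ Disjoint e f) N

  -- The list increases in weight and the recursion handles the tail first, so `e` is considered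
  -- after all heavier edges. That `N` is drawn from `es` is carried along to compare the weight of
  -- `e` with that of a conflicting edge.
  greedy : ∀ {p} {P : Pred (Edge n) p} {es} → All P es → AllPairs (λ e f → w e ≤ w f) es →
           ∃[ N ] All P N × AllPairs Disjoint N × All (_∈ es) N × All (DominatesFromAbove N) es
  greedy [] [] = [] , [] , [] , [] , []
  greedy {es = e ∷ es} (pe ∷ pes) (e≤ ∷ sorted) with greedy pes sorted
  ... | N , pN , dN , N⊆es , dom with any? (λ f → ¬? (disjoint? e f)) N
  ...   | yes conflict = N , pN , dN , All.map there N⊆es , above ∷ dom
    where
    above : DominatesFromAbove N e
    above = let (f , f∈N , ¬d) = find conflict in
            lose f∈N (All.lookup e≤ (All.lookup N⊆es f∈N) , ¬d)
  ...   | no ∄ = e ∷ N , pe ∷ pN , All.map (λ {f} → decidable-stable (disjoint? e f)) (All.¬Any⇒All¬ N ∄) ∷ dN ,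
                 here refl ∷ All.map there N⊆es , here (≤-refl , ¬disjoint-refl e) ∷ All.map there dom

  greedyMatching : ∀ {a} {L : Set a} (G : Graph L n) →
                   ∃[ N ] IsMatching G N × (∀ e → Is-just (G e) → DominatesFromAbove N e)
  greedyMatching G =
    let es = filter (isEdge? G) allEdges
        σ = sort-↭ es
        (N , eN , dN , _ , dom) = greedy (All-resp-↭ (↭-sym σ) (All.all-filter (isEdge? G) allEdges))
                                    (Linked⇒AllPairs ≤-trans (sort-↗ es))
    in N , record { edges = eN ; disjoint = dN } , λ e e∈G →
       All.lookup dom (∈-resp-↭ (↭-sym σ) (∈-filter⁺ (isEdge? G) (∈-allEdges e) e∈G))

  -- An edge of `M` is met by an edge of `N` at least as heavy; `P` passes up to it, so it survives
  -- the filter and the filtered list still dominates `M`.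
  length≤2*filter : ∀ {p} {P : Pred (Edge n) p} (P? : Decidable P) → (∀ {e f} → w e ≤ w f → P e → P f) →
                    ∀ {M N} → AllPairs Disjoint M → All P M → All (DominatesFromAbove N) M →
                    length M ℕ.≤ 2 ℕ.* length (filter P? N)
  length≤2*filter P? upward {N = N} dM pM domM =
    length≤2*dominating dM (All.zipWith dominates (pM , domM))
    where
    dominates : ∀ {e} → _ × DominatesFromAbove N e → Dominates (filter P? N) e
    dominates (pe , dom) = let (f , f∈N , e≤f , ¬d) = find dom in
                           lose (∈-filter⁺ P? f∈N (upward e≤f pe)) ¬d

-- The union bound.

module Probability {c ℓ₁ ℓ₂ o e} (F : OrderedField c ℓ₁ ℓ₂) (Pr : ProbabilitySpace F o e) where
  open OrderedFieldProperties F
  open ProbabilitySpace Pr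

  -- The union is `X` together with `Y∖X`, and `Y` is `Y∩X` together with `Y∖X`. Events are closed
  -- under complement and union, so both pieces are written by De Morgan.
  ℙ-∨≤ : ∀ {X Y} (p : IsEvent X) (q : IsEvent Y) →
         ℙ (λ ω → X ω ∨ Y ω) (union p q) ≤ ℙ X p + ℙ Y q
  ℙ-∨≤ {X} {Y} p q = begin
    ℙ (λ ω → X ω ∨ Y ω) (union p q)   ≈⟨ ℙ-cong _ _ (λ ω → ∨-split (X ω) (Y ω)) ⟩
    ℙ (λ ω → X ω ∨ not (X ω ∨ not (Y ω))) (union p Y∖X)
      ≈⟨ ℙ-add p Y∖X (λ ω → ∖-disjoint (X ω) (Y ω)) ⟩
    ℙ X p + ℙ _ Y∖X                   ≤⟨ +-monoʳ-≤ _ (x≤y+x (ℙ-nonNeg Y∩X)) ⟩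
    ℙ X p + (ℙ _ Y∩X + ℙ _ Y∖X)      ≈⟨ +-congˡ (ℙ-add Y∩X Y∖X (λ ω → ∩∖-disjoint (X ω) (Y ω))) ⟨
    ℙ X p + ℙ _ (union Y∩X Y∖X)       ≈⟨ +-congˡ (ℙ-cong _ _ (λ ω → ∩∖-split (X ω) (Y ω))) ⟩
    ℙ X p + ℙ Y q                     ∎
    where
    Y∖X : IsEvent (λ ω → not (X ω ∨ not (Y ω)))
    Y∖X = compl (union p (compl q))
    Y∩X : IsEvent (λ ω → not (not (X ω) ∨ not (Y ω)))
    Y∩X = compl (union (compl p) (compl q))
    ∨-split : ∀ x y → x ∨ y ≡ x ∨ not (x ∨ not y)
    ∨-split true  _     = refl
    ∨-split false true  = refl
    ∨-split false false = refl
    ∖-disjoint : ∀ x y → x ∧ not (x ∨ not y) ≡ false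
    ∖-disjoint true  _ = refl
    ∖-disjoint false _ = refl
    ∩∖-disjoint : ∀ x y → not (not x ∨ not y) ∧ not (x ∨ not y) ≡ false
    ∩∖-disjoint true  true  = refl
    ∩∖-disjoint true  false = refl
    ∩∖-disjoint false _     = refl
    ∩∖-split : ∀ x y → not (not x ∨ not y) ∨ not (x ∨ not y) ≡ y
    ∩∖-split true  true  = refl
    ∩∖-split true  false = refl
    ∩∖-split false true  = refl
    ∩∖-split false false = refl

  union-bound : ∀ {g δ} k {Good : Fin (suc k) → Ω → Set g} →
                (∀ i → FailsWithProbability≤ F Pr δ (Good i)) →
                FailsWithProbability≤ F Pr (δ * ι (suc k)) (λ ω → ∀ i → Good i ω)
  union-bound {δ = δ} zero fails with fails zero
  ... | X , p , ℙX≤δ , good =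
    X , p ,
    ≤-trans ℙX≤δ (≤-reflexive (sym (trans (*-congˡ (+-identityʳ 1#)) (*-identityʳ _)))) ,
    λ { ω Xω zero → good ω Xω }
  union-bound {δ = δ} (suc k) fails with fails zero | union-bound k (fails ∘ suc)
  ... | X , p , ℙX≤δ , good | Y , q , ℙY≤kδ , goods =
    (λ ω → X ω ∨ Y ω) , union p q ,
    (begin
      ℙ _ (union p q)      ≤⟨ ℙ-∨≤ p q ⟩
      ℙ X p + ℙ Y q        ≤⟨ +-mono-≤ ℙX≤δ ℙY≤kδ ⟩
      δ + δ * ι (suc k)    ≈⟨ +-congʳ (*-identityʳ δ) ⟨
      δ * 1# + δ * ι (suc k) ≈⟨ distribˡ δ 1# (ι (suc k)) ⟨
      δ * ι (suc (suc k))  ∎) ,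
    λ { ω XYω zero → good ω (∨-falseˡ XYω) ; ω XYω (suc i) → goods ω (∨-falseʳ {X ω} XYω) i }
    where
    ∨-falseˡ : ∀ {x y} → x ∨ y ≡ false → x ≡ false
    ∨-falseˡ {false} _ = refl
    ∨-falseʳ : ∀ {x y} → x ∨ y ≡ false → y ≡ false
    ∨-falseʳ {false} eq = eq

-- Restricting a labelled graph and its stream to the kept labels.

module Restriction {a ℓ} (L : Setoid a ℓ) (kept : Setoid.Carrier L → Bool)
  (kept-cong : ∀ {x y} → Setoid._≈_ L x y → kept x ≡ kept y) {n : ℕ} where
  open Setoid L using (_≈_) renaming (Carrier to Label)

  keep : Label → Maybe ⊤
  keep x = if kept x then just tt else nothing

  subgraph : Graph Label n → Graph ⊤ n
  subgraph G e = G e >>= keep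

  restrict : Stream Label n → Stream ⊤ n
  restrict []             = []
  restrict (ins e x ∷ us) = if kept x then ins e tt ∷ restrict us else restrict us
  restrict (del e x ∷ us) = if kept x then del e tt ∷ restrict us else restrict us

  >>=keep-cong : ∀ {x y} → Pointwise _≈_ x y → (x >>= keep) ≡ (y >>= keep)
  >>=keep-cong (just x≈y) = ≡.cong (if_then just tt else nothing) (kept-cong x≈y)
  >>=keep-cong nothing    = refl

  -- Legality depends on the graph reached so far, so the induction keeps arbitrary current graphs
  -- `G` and `H` in step. `H` agrees with the subgraph only pointwise.
  restrict-valid : ∀ m {G : Graph Label n} {H : Graph ⊤ n} us → (∀ e → H e ≡ subgraph G e) →
    ValidFrom L m G us →
    ValidFrom (setoid ⊤) m H (restrict us) ×
    (∀ e → foldl apply H (restrict us) e ≡ subgraph (foldl apply G us) e)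
  restrict-valid m [] H≡ _ = Poly.tt , H≡
  restrict-valid m {G} {H} (ins e x ∷ us) H≡ ((_ , Ge≡) , valid) with kept x in kx
  ... | true =
    let (v , f) = restrict-valid m us after valid in ((Poly.tt , absent) , v) , f
    where
    absent : H e ≡ nothing
    absent rewrite H≡ e | Ge≡ = refl
    after : ∀ f → (H [ e ]≔ just tt) f ≡ subgraph (G [ e ]≔ just x) f
    after f with e ≟ᴱ f
    ... | yes _ rewrite kx = refl
    ... | no _  = H≡ f
  ... | false = restrict-valid m us after valid
    where
    -- By legality `e` was absent before, hence absent from `H`, and its new label is not kept.
    after : ∀ f → H f ≡ subgraph (G [ e ]≔ just x) f
    after f with e ≟ᴱ f
    ... | yes refl rewrite H≡ e | Ge≡ | kx = refl
    ... | no _  = H≡ f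
  restrict-valid dynamic {G} {H} (del e x ∷ us) H≡ (Ge≈x , valid) with kept x in kx
  ... | true =
    let (v , f) = restrict-valid dynamic us after valid in (present , v) , f
    where
    present : Pointwise _≡_ (H e) (just tt)
    present rewrite H≡ e | >>=keep-cong Ge≈x | kx = just refl
    after : ∀ f → (H [ e ]≔ nothing) f ≡ subgraph (G [ e ]≔ nothing) f
    after f with e ≟ᴱ f
    ... | yes _ = refl
    ... | no _  = H≡ f
  ... | false = restrict-valid dynamic us after valid
    where
    -- The stored label is equivalent to `x`, so by `kept-cong` it is not kept either and `e` is
    -- already absent from `H`.
    after : ∀ f → H f ≡ subgraph (G [ e ]≔ nothing) f
    after f with e ≟ᴱ f
    ... | yes refl rewrite H≡ e | >>=keep-cong Ge≈x | kx = refl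
    ... | no _  = H≡ f

  restrict-presents : ∀ {m us G} → Presents L m us G → Presents (setoid ⊤) m (restrict us) (subgraph G)
  restrict-presents {m} {us} {G} pres =
    let (v , f) = restrict-valid m us (λ _ → refl) (Presents.valid pres) in record
    { valid = v
    ; final = λ e → Pointwise.reflexive id (≡.trans (f e) (>>=keep-cong (Presents.final pres e)))
    }

  subgraph⁻ : ∀ {G e} → Is-just (subgraph G e) → ∃[ x ] G e ≡ just x × kept x ≡ true
  subgraph⁻ {G} {e} p with G e
  ... | just x with kept x in kx
  ...   | true = x , refl , kx

  subgraph⁺ : ∀ G e → Is-just (G e) → (∀ {x} → G e ≡ just x → kept x ≡ true) → Is-just (subgraph G e)
  subgraph⁺ G e e∈G k with G e
  ... | just x rewrite k refl = just tt

-- Weight classes as threshold conditions.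

module WeightClasses {c ℓ₁ ℓ₂} (F : OrderedField c ℓ₁ ℓ₂) {t : ℕ} where
  open OrderedFieldProperties F
  open SuffixSums F

  <-respˡ : ∀ {x y z} → x ≈ y → x < z → y < z
  <-respˡ x≈y (x≤z , x≉z) = ≤-respˡ-≈ x≈y x≤z , x≉z ∘ trans x≈y

  inClasses≥-cong : ∀ (i : Fin (suc t)) {x y} → x ≈ y → InClasses≥ F i x → InClasses≥ F i y
  inClasses≥-cong i x≈y (j , i≤j , r≤x , x<r) = j , i≤j , ≤-respʳ-≈ x≈y r≤x , <-respˡ x≈y x<r

  inClasses≥⇒r≤ : ∀ {i : Fin (suc t)} {x} → InClasses≥ F i x → r F (toℕ i) ≤ x
  inClasses≥⇒r≤ (j , i≤j , rj≤x , _) = ≤-trans (r-mono i≤j) rj≤x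

  -- The class is found by climbing from `i`; `d` counts the classes left up to `t`, and the bound
  -- on `x` stops the climb at `t` at the latest.
  r≤⇒inClasses≥ : ∀ {i : Fin (suc t)} {x} → x < r F (suc t) → r F (toℕ i) ≤ x → InClasses≥ F i x
  r≤⇒inClasses≥ {i} {x} x<r ri≤x =
    search (t ℕ.∸ toℕ i) (toℕ i) ℕ.≤-refl (ℕ.m+[n∸m]≡n (ℕ.≤-pred (Fin.toℕ<n i))) ri≤x
    where
    search : ∀ d k → toℕ i ℕ.≤ k → k ℕ.+ d ≡ t → r F k ≤ x → InClasses≥ F i x
    search d k i≤k k+d≡t rk≤x with x <? r F (suc k)
    ... | yes x<rk = fromℕ< k<st , ≡.subst (toℕ i ℕ.≤_) (≡.sym k≡) i≤k ,
                     ≡.subst (λ k → r F k ≤ x) (≡.sym k≡) rk≤x ,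
                     ≡.subst (λ k → x < r F (suc k)) (≡.sym k≡) x<rk
      where
      k<st : k ℕ.< suc t
      k<st = s≤s (≡.subst (k ℕ.≤_) k+d≡t (ℕ.m≤m+n k d))
      k≡ : toℕ (fromℕ< k<st) ≡ k
      k≡ = Fin.toℕ-fromℕ< k<st
    search zero k i≤k k+0≡t rk≤x | no x≮ =
      contradiction (≡.subst (λ k → x < r F (suc k)) (≡.trans (≡.sym k+0≡t) (ℕ.+-identityʳ k)) x<r) x≮
    search (suc d) k i≤k k+d≡t rk≤x | no x≮ =
      search d (suc k) (ℕ.m≤n⇒m≤1+n i≤k) (≡.trans (≡.sym (ℕ.+-suc k d)) k+d≡t) (≮⇒≥ x≮)

  does-inClasses≥-cong : ∀ (i : Fin (suc t)) {x y} → x ≈ y →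
                         does (inClasses≥? F i x) ≡ does (inClasses≥? F i y)
  does-inClasses≥-cong i {x} {y} x≈y =
    does-⇔ (mk⇔ (inClasses≥-cong i x≈y) (inClasses≥-cong i (sym x≈y)))
           (inClasses≥? F i x) (inClasses≥? F i y)

  -- The labels are filtered by the same test that decides which updates reach copy `i` of the
  -- algorithm.
  module Class≥ {n} (i : Fin (suc t)) =
    Restriction ≈-setoid (does ∘ inClasses≥? F i) (does-inClasses≥-cong i) {n}

-- Matching weights against class counts.

module Analysis {c ℓ₁ ℓ₂} (F : OrderedField c ℓ₁ ℓ₂) {n t : ℕ} {W : OrderedField.Carrier F}
  (W-floor : IsFloorLog₂ F W t) {G : WeightedGraph F n} (weights : WeightsFrom1To F W G) where
  open OrderedFieldProperties F
  open SuffixSums F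
  open WeightClasses F {t}
  open Class≥ using (subgraph; subgraph⁻; subgraph⁺)

  -- The default `0#` is the one in `weight`, so `weight F G` is the sum of `w` over the list.
  w : Edge n → Carrier
  w e = fromMaybe 0# (G e)

  open GreedyMatching decTotalOrder w

  w-bounds : ∀ {e} → Is-just (G e) → 1# ≤ w e × w e < r F (suc t)
  w-bounds {e} e∈G with G e | weights e
  ... | just x | MaybeAll.just (1≤x , x≤W) =
    1≤x , ≤-<-trans x≤W (proj₂ W-floor)

  subgraph-edge⁻ : ∀ i {e} → Is-just (subgraph i G e) → Is-just (G e) × r F (toℕ i) ≤ w e
  subgraph-edge⁻ i {e} p with subgraph⁻ i {G} p
  ... | x , Ge , kx rewrite Ge = just tt , inClasses≥⇒r≤ (does≡true⇒ (inClasses≥? F i x) kx)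

  subgraph-edge⁺ : ∀ i {e} → Is-just (G e) → r F (toℕ i) ≤ w e → Is-just (subgraph i G e)
  subgraph-edge⁺ i {e} e∈G ri≤w = subgraph⁺ i G e e∈G λ {x} Ge≡x →
    dec-true (inClasses≥? F i x) (≡.subst (InClasses≥ F i) (≡.cong (fromMaybe 0#) Ge≡x)
      (r≤⇒inClasses≥ (proj₂ (w-bounds e∈G)) ri≤w))

  heavy? : ∀ i e → Dec (r F i ≤ w e)
  heavy? i e = r F i ≤? w e

  count : ℕ → List (Edge n) → ℕ
  count i M = length (filter (heavy? i) M)

  ∑gap*count : List (Edge n) → Carrier
  ∑gap*count M = sum {suc t} λ i → gap (toℕ i) * ι (count (toℕ i) M)

  -- Regrouped by edges, the left side adds up the gaps below each edge weight, which telescope to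
  -- at most that weight.
  ∑gap*count≤weight : ∀ {M} → All (Is-just ∘ G) M → ∑gap*count M ≤ weight F G M
  ∑gap*count≤weight {M} M⊆G = ≤-trans (≤-reflexive (weightedCounts (suc t) w M)) (go M⊆G)
    where
    go : ∀ {M} → All (Is-just ∘ G) M →
         List.foldr (λ e x → gapsBelow (suc t) 0 (w e) + x) 0# M ≤ weight F G M
    go []            = ≤-refl
    go (e∈G ∷ M⊆G) = +-mono-≤ (gapsBelow≤x (suc t) (≤-trans 0≤1 (proj₁ (w-bounds e∈G)))) (go M⊆G)

  weight≤2*∑gap*count : ∀ {M} → All (Is-just ∘ G) M → weight F G M ≤ ι 2 * ∑gap*count M
  weight≤2*∑gap*count {M} M⊆G = ≤-trans (go M⊆G) (≤-reflexive (*-congˡ (sym (weightedCounts (suc t) w M))))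
    where
    go : ∀ {M} → All (Is-just ∘ G) M →
         weight F G M ≤ ι 2 * List.foldr (λ e x → gapsBelow (suc t) 0 (w e) + x) 0# M
    go []            = ≤-reflexive (sym (zeroʳ _))
    go (e∈G ∷ M⊆G) = ≤-trans
      (+-mono-≤ (let (1≤w , w<r) = w-bounds e∈G in x≤2*gapsBelow t 1≤w w<r) (go M⊆G))
      (≤-reflexive (sym (distribˡ _ _ _)))

  ν : Fin (suc t) → ℕ
  ν i = length (proj₁ (maximumMatching (subgraph i G)))

  count≤ν : ∀ {M} → IsMatching G M → ∀ i → count (toℕ i) M ℕ.≤ ν i
  count≤ν {M} m i = IsMaximumMatching.maximum (proj₂ (maximumMatching (subgraph i G))) _ record
    { edges = All.zipWith (λ {e} (e∈G , ri≤w) → subgraph-edge⁺ i {e} e∈G ri≤w)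
                (All.filter⁺ (heavy? (toℕ i)) edges , All.all-filter (heavy? (toℕ i)) M)
    ; disjoint = AllPairs.filter⁺ (heavy? (toℕ i)) disjoint
    }
    where open IsMatching m

  N : List (Edge n)
  N = proj₁ (greedyMatching G)

  N-isMatching : IsMatching G N
  N-isMatching = proj₁ (proj₂ (greedyMatching G))

  -- Edges of classes from `j` on weigh at least `r F (toℕ i)`, and `N` dominates them from above.
  -- Two indices are allowed because a suffix sum at `i` is only known to be an estimate at some `j`
  -- not below `i`.
  ν≤2*count : ∀ {i j : Fin (suc t)} → i Fin.≤ j → ν j ℕ.≤ 2 ℕ.* count (toℕ i) N
  ν≤2*count {i} {j} i≤j = length≤2*filter (heavy? (toℕ i)) (λ w≤w r≤w → ≤-trans r≤w w≤w) disjoint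
    (All.map (λ e∈Gⱼ → ≤-trans (r-mono {toℕ i} {toℕ j} i≤j) (proj₂ (subgraph-edge⁻ j e∈Gⱼ))) edges)
    (All.map (λ e∈Gⱼ → proj₂ (proj₂ (greedyMatching G)) _ (proj₁ (subgraph-edge⁻ j e∈Gⱼ))) edges)
    where open IsMatching (IsMaximumMatching.isMatching (proj₂ (maximumMatching (subgraph j G))))

  -- Both bounds on `Ŵ` when all estimates are good.

  module _ {Λ} (1≤Λ : 1# ≤ Λ) (M̂ : Vector Carrier (suc t))
    (estimates : ∀ i → Λ ⁻¹ * ι (ν i) ≤ M̂ i × M̂ i ≤ ι (ν i))
    {M*} (M*-max : IsMaximumWeightMatching F G M*) where
    open EvaluationProperties F M̂
    open Evaluation F 1# 0# M̂ using (Ŵ; end)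
    open Registers end using (R̂)
    open Processed end-processed
    open IsMaximumWeightMatching M*-max

    0<Λ : 0# < Λ
    0<Λ = <-≤-trans 0<1 1≤Λ

    Q : Carrier
    Q = sum (λ i → r F (toℕ i) * R̂ i)

    5*Ŵ≈2*Q : ι 5 * Ŵ ≈ ι 2 * Q
    5*Ŵ≈2*Q = begin-equality
      ι 5 * (ι 2 * ι 5 ⁻¹ * Q)   ≈⟨ *-congˡ (*-congʳ (*-comm (ι 2) (ι 5 ⁻¹))) ⟩
      ι 5 * (ι 5 ⁻¹ * ι 2 * Q)   ≈⟨ *-congˡ (*-assoc (ι 5 ⁻¹) (ι 2) Q) ⟩
      ι 5 * (ι 5 ⁻¹ * (ι 2 * Q)) ≈⟨ x*[x⁻¹*y]≈y (ι-pos 4) _ ⟩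
      ι 2 * Q                    ∎

    suffixSum≤ : ∀ i → suffixSum R̂ i ≤ ι 2 * ι (count (toℕ i) N)
    suffixSum≤ i = let (j , i≤j , σ≈M̂j) = attained i z≤n in begin
      suffixSum R̂ i                 ≈⟨ σ≈M̂j ⟩
      M̂ j                           ≤⟨ proj₂ (estimates j) ⟩
      ι (ν j)                        ≤⟨ ι-mono (ν≤2*count {i} {j} i≤j) ⟩
      ι (2 ℕ.* count (toℕ i) N)      ≈⟨ ×1-homo-* 2 (count (toℕ i) N) ⟩
      ι 2 * ι (count (toℕ i) N)      ∎

    Q≤2*weight : Q ≤ ι 2 * weight F G M*
    Q≤2*weight = begin
      Q
        ≈⟨ ∑r*v≈∑gap*suffixSum R̂ ⟩
      sum (λ i → gap (toℕ i) * suffixSum R̂ i)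
        ≤⟨ sum-mono-≤ (λ i → *-monoʳ-≤ (gap-nonNeg (toℕ i)) (suffixSum≤ i)) ⟩
      sum {suc t} (λ i → gap (toℕ i) * (ι 2 * ι (count (toℕ i) N)))
        ≈⟨ sum-cong-≋ {suc t} (λ i → *-x∙yz≈y∙xz (gap (toℕ i)) (ι 2) (ι (count (toℕ i) N))) ⟩
      sum {suc t} (λ i → ι 2 * (gap (toℕ i) * ι (count (toℕ i) N)))
        ≈⟨ *-distribˡ-sum {suc t} (ι 2) (λ i → gap (toℕ i) * ι (count (toℕ i) N)) ⟨
      ι 2 * ∑gap*count N
        ≤⟨ *-monoʳ-≤ (ι-nonNeg 2) (∑gap*count≤weight (IsMatching.edges N-isMatching)) ⟩
      ι 2 * weight F G N
        ≤⟨ *-monoʳ-≤ (ι-nonNeg 2) (maximum N N-isMatching) ⟩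
      ι 2 * weight F G M* ∎

    -- Comparison with the empty matching, whose weight is `0#`.
    weight-nonNeg : 0# ≤ weight F G M*
    weight-nonNeg = maximum [] record { edges = [] ; disjoint = [] }

    Ŵ≤weight : Ŵ ≤ weight F G M*
    Ŵ≤weight = begin
      Ŵ                      ≈⟨ x⁻¹*[x*y]≈y (ι-pos 4) Ŵ ⟨
      ι 5 ⁻¹ * (ι 5 * Ŵ)     ≤⟨ y≤x*z⇒x⁻¹*y≤z (ι-pos 4) 5Ŵ≤5w ⟩
      weight F G M*          ∎
      where
      5Ŵ≤5w : ι 5 * Ŵ ≤ ι 5 * weight F G M*
      5Ŵ≤5w = begin
        ι 5 * Ŵ                         ≈⟨ 5*Ŵ≈2*Q ⟩
        ι 2 * Q                         ≤⟨ *-monoʳ-≤ (ι-nonNeg 2) Q≤2*weight ⟩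
        ι 2 * (ι 2 * weight F G M*)     ≈⟨ *-assoc _ _ _ ⟨
        ι 2 * ι 2 * weight F G M*       ≈⟨ *-congʳ (×1-homo-* 2 2) ⟨
        -- The factor 2/5 in `Ŵ` leaves room: only a factor 4 has accumulated against the
        -- denominator 5.
        ι 4 * weight F G M*             ≤⟨ *-monoˡ-≤ weight-nonNeg (ι-mono (ℕ.n≤1+n 4)) ⟩
        ι 5 * weight F G M*             ∎

    count≤Λ*suffixSum : ∀ i → ι (count (toℕ i) M*) ≤ Λ * suffixSum R̂ i
    count≤Λ*suffixSum i = begin
      ι (count (toℕ i) M*) ≤⟨ ι-mono (count≤ν isMatching i) ⟩
      ι (ν i)              ≤⟨ x⁻¹*y≤z⇒y≤x*z 0<Λ (proj₁ (estimates i)) ⟩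
      Λ * M̂ i              ≤⟨ *-monoʳ-≤ (proj₁ 0<Λ) (bounds i z≤n) ⟩
      Λ * suffixSum R̂ i    ∎

    ∑gap*count≤Λ*Q : ∑gap*count M* ≤ Λ * Q
    ∑gap*count≤Λ*Q = begin
      ∑gap*count M*
        ≤⟨ sum-mono-≤ (λ i → *-monoʳ-≤ (gap-nonNeg (toℕ i)) (count≤Λ*suffixSum i)) ⟩
      sum {suc t} (λ i → gap (toℕ i) * (Λ * suffixSum R̂ i))
        ≈⟨ sum-cong-≋ {suc t} (λ i → *-x∙yz≈y∙xz (gap (toℕ i)) Λ (suffixSum R̂ i)) ⟩
      sum {suc t} (λ i → Λ * (gap (toℕ i) * suffixSum R̂ i))
        ≈⟨ *-distribˡ-sum {suc t} Λ (λ i → gap (toℕ i) * suffixSum R̂ i) ⟨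
      Λ * sum {suc t} (λ i → gap (toℕ i) * suffixSum R̂ i)
        ≈⟨ *-congˡ (∑r*v≈∑gap*suffixSum R̂) ⟨
      Λ * Q ∎

    weight≤Λ*[5*Ŵ] : weight F G M* ≤ Λ * (ι 5 * Ŵ)
    weight≤Λ*[5*Ŵ] = begin
      weight F G M*        ≤⟨ weight≤2*∑gap*count (IsMatching.edges isMatching) ⟩
      ι 2 * ∑gap*count M*  ≤⟨ *-monoʳ-≤ (ι-nonNeg 2) ∑gap*count≤Λ*Q ⟩
      ι 2 * (Λ * Q)        ≈⟨ *-x∙yz≈y∙xz (ι 2) Λ Q ⟩
      Λ * (ι 2 * Q)        ≈⟨ *-congˡ 5*Ŵ≈2*Q ⟨
      Λ * (ι 5 * Ŵ)        ∎

    -- The sign is read off from the lower bound itself, since the weight of `M*` is nonnegative and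
    -- `Λ` is positive. It is what allows `Λ` to be replaced by `Λ ^ 4` below.
    5*Ŵ-nonNeg : 0# ≤ ι 5 * Ŵ
    5*Ŵ-nonNeg = begin
      0#                         ≤⟨ *-nonNeg (⁻¹-nonNeg 0<Λ) weight-nonNeg ⟩
      Λ ⁻¹ * weight F G M*       ≤⟨ y≤x*z⇒x⁻¹*y≤z 0<Λ weight≤Λ*[5*Ŵ] ⟩
      ι 5 * Ŵ                    ∎

    weight≤5*Λ⁴*Ŵ : weight F G M* ≤ ι 5 * Λ ^ 4 * Ŵ
    weight≤5*Λ⁴*Ŵ = begin
      weight F G M*          ≤⟨ weight≤Λ*[5*Ŵ] ⟩
      Λ * (ι 5 * Ŵ)          ≤⟨ *-monoˡ-≤ 5*Ŵ-nonNeg Λ≤Λ⁴ ⟩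
      Λ ^ 4 * (ι 5 * Ŵ)      ≈⟨ *-x∙yz≈y∙xz (Λ ^ 4) (ι 5) Ŵ ⟩
      ι 5 * (Λ ^ 4 * Ŵ)      ≈⟨ *-assoc _ _ _ ⟨
      ι 5 * Λ ^ 4 * Ŵ        ∎
      where
      Λ≤Λ⁴ : Λ ≤ Λ ^ 4
      Λ≤Λ⁴ = ≤-trans (≤-reflexive (sym (*-identityʳ Λ))) (*-monoʳ-≤ (proj₁ 0<Λ) (1≤x^n 1≤Λ 3))

    approximation : (ι 5 * Λ ^ 4) ⁻¹ * weight F G M* ≤ Ŵ × Ŵ ≤ weight F G M*
    approximation = y≤x*z⇒x⁻¹*y≤z (*-pos (ι-pos 4) (^-pos 0<Λ 4)) weight≤5*Λ⁴*Ŵ , Ŵ≤weight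

-- The copies run on restricted streams, and their total space.

module Algorithm {c ℓ₁ ℓ₂ o o′ s} (F : OrderedField c ℓ₁ ℓ₂) {Ω : Set o} {Ω′ : Set o′} {n t : ℕ}
  (A : StreamingAlgorithm F s ⊤ n Ω) (seed : Fin (suc t) → Ω′ → Ω) where
  open OrderedField F
  open WeightClasses F {t}
  open Class≥ {n} using (restrict; restrict-valid)
  module A = StreamingAlgorithm A
  B = weightedMatching F 1# 0# t A seed
  module B = StreamingAlgorithm B

  -- Moves the choice from the state, where the algorithm makes it, to the stream, where `restrict`
  -- makes it.
  foldl-if : ∀ b σ {u us} → foldl A.step (if b then A.step σ u else σ) us ≡
                            foldl A.step σ (if b then u ∷ us else us)
  foldl-if true  σ = refl
  foldl-if false σ = refl

  foldl-step : ∀ i σ us → foldl B.step σ us i ≡ foldl A.step (σ i) (restrict i us)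
  foldl-step i σ []             = refl
  foldl-step i σ (ins e x ∷ us) = ≡.trans (foldl-step i (B.step σ (ins e x)) us)
                                          (foldl-if (does (inClasses≥? F i x)) (σ i))
  foldl-step i σ (del e x ∷ us) = ≡.trans (foldl-step i (B.step σ (del e x)) us)
                                          (foldl-if (does (inClasses≥? F i x)) (σ i))

  output-run : ∀ ω us i → A.output (B.run ω us i) ≡ A.result (seed i ω) (restrict i us)
  output-run ω us i = ≡.cong A.output (foldl-step i (B.init ω) us)

  total-space : ∀ {k S} (σ : Vector A.State k) → (∀ i → A.space (σ i) ℕ.≤ S) →
                Vector.foldr ℕ._+_ 0 (A.space ∘ σ) ℕ.≤ k ℕ.* S
  total-space {zero}  σ ≤S = z≤n
  total-space {suc k} σ ≤S = ℕ.+-mono-≤ (≤S zero) (total-space (σ ∘ suc) (≤S ∘ suc))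

  usesSpace : ∀ {m S} → UsesSpace F (setoid ⊤) m S A → UsesSpace F ≈-setoid m (6 ℕ.* (S ℕ.* suc t)) B
  usesSpace {m} {S} A-space ω us valid = begin
    3 ℕ.+ (2 ℕ.* suc t ℕ.+ Vector.foldr ℕ._+_ 0 (A.space ∘ σ))
      ≤⟨ ℕ.+-monoʳ-≤ 3 (ℕ.+-monoʳ-≤ (2 ℕ.* suc t) (total-space σ copy-space)) ⟩
    3 ℕ.+ (2 ℕ.* suc t ℕ.+ suc t ℕ.* S)
      ≡⟨ ≡.cong (λ x → 3 ℕ.+ (2 ℕ.* suc t ℕ.+ x)) (ℕ.*-comm (suc t) S) ⟩
    -- The constant 6 is 3 + 2 + 1, as both 1 and `suc t` are at most `P`.
    3 ℕ.* 1 ℕ.+ (2 ℕ.* suc t ℕ.+ P)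
      ≤⟨ ℕ.+-mono-≤ (ℕ.*-monoʳ-≤ 3 (ℕ.≤-trans (s≤s z≤n) 1+t≤P)) (ℕ.+-monoˡ-≤ P (ℕ.*-monoʳ-≤ 2 1+t≤P)) ⟩
    3 ℕ.* P ℕ.+ (2 ℕ.* P ℕ.+ P)
      ≡⟨ collect P ⟩
    6 ℕ.* P ∎
    where
    open ℕ.≤-Reasoning
    σ = B.run ω us
    P = S ℕ.* suc t
    copy-space : ∀ i → A.space (σ i) ℕ.≤ S
    copy-space i rewrite foldl-step i (B.init ω) us =
      A-space (seed i ω) (restrict i us) (proj₁ (restrict-valid i m us (λ _ → refl) valid))
    -- A copy uses at least one word and at most `S`, so `S` is at least 1.
    1+t≤P : suc t ℕ.≤ P
    1+t≤P = ≡.subst (ℕ._≤ P) (ℕ.*-identityˡ (suc t))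
      (ℕ.*-monoˡ-≤ (suc t) (ℕ.≤-trans (A.1≤space (σ zero)) (copy-space zero)))
    collect : ∀ p → 3 ℕ.* p ℕ.+ (2 ℕ.* p ℕ.+ p) ≡ 6 ℕ.* p
    collect = solve-∀

theorem1 : ∀ {c ℓ₁ ℓ₂ o e o′ e′ s : Level} (F : OrderedField c ℓ₁ ℓ₂) →
    let open OrderedField F in
    Σ[ K ∈ Carrier ] 0# < K × (Σ[ C ∈ ℕ ]
    ∀ (Λ : Carrier) → 1# ≤ Λ →
    Σ[ T ∈ Carrier ] Σ[ κ ∈ Carrier ]
    ∀ (n : ℕ) (m : Model) (Pr : ProbabilitySpace F o e)
    (A : StreamingAlgorithm F s ⊤ n (ProbabilitySpace.Ω Pr))
    (δ : Carrier) (S : ℕ) →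
    EstimatesMatching F Pr A m Λ δ →
    UsesSpace F (setoid ⊤) m S A →
    ∀ (W : Carrier) (t : ℕ) → IsFloorLog₂ F W t →
    ∀ (copies : Copies F o′ e′ Pr (suc t)) →
    let B = weightedMatching F T κ t A (Copies.seed copies) in
    UsesSpace F ≈-setoid m (C ℕ.* (S ℕ.* suc t)) B ×
    (∀ (G : WeightedGraph F n) → WeightsFrom1To F W G →
    ∀ us → Presents ≈-setoid m us G →
    ∀ M* → IsMaximumWeightMatching F G M* →
    FailsWithProbability≤ F (Copies.joint copies) (δ * ι (suc t)) λ ω →
    (K * Λ ^ 4) ⁻¹ * weight F G M* ≤ StreamingAlgorithm.result B ω us ×
    StreamingAlgorithm.result B ω us ≤ weight F G M*))
-- The approximation constant 5 comes from `weight≤5*Λ⁴*Ŵ` and the space constant 6 from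
-- `usesSpace`.
theorem1 {ℓ₁ = ℓ₁} F = ι 5 , ι-pos 4 , 6 , λ Λ 1≤Λ → 1# , 0# ,
  λ n m Pr A δ S estimates A-space W t W-floor copies →
  let open Copies copies
      open Algorithm F A seed
      open WeightClasses F {t} using (module Class≥)
      open Class≥ {n} using (restrict; subgraph; restrict-presents)
  in usesSpace A-space , λ G weights us presents M* M*-max →
  let open Analysis F {t = t} W-floor weights using (ν; approximation)
      fails : ∀ i → FailsWithProbability≤ F joint δ λ ω →
                Λ ⁻¹ * ι (ν i) ≤ A.result (seed i ω) (restrict i us) ×
                A.result (seed i ω) (restrict i us) ≤ ι (ν i)
      fails i =
        let (X , p , ℙX≤δ , good) =
              estimates (subgraph i G) (restrict i us) (restrict-presents i presents) _
                (proj₂ (maximumMatching (subgraph i G)))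
        -- The failure event of `A` is pulled back along the seed of copy `i`, which preserves its
        -- probability.
        in X ∘ seed i , seed-event i p , ≤-trans (≤-reflexive (seed-preserve i p)) ℙX≤δ ,
           λ ω → good (seed i ω)
      (X , p , ℙX≤ , good) = Probability.union-bound F joint t fails
  in X , p , ℙX≤ , λ ω Xω →
     approximation 1≤Λ (A.output ∘ B.run ω us)
       (λ i → ≡.subst (λ x → Λ ⁻¹ * ι (ν i) ≤ x × x ≤ ι (ν i)) (≡.sym (output-run ω us i)) (good ω Xω i))
       M*-max
  where open OrderedFieldProperties F
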